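{- Let $x_1,\dots,x_m$, $y_1,\dots,y_n$ be variables and $z_1,z_2,\dots$ nonzero parameters. Then $$\sum_\lambda G_\lambda(x_1,\dots,x_m;z_1,\dots,z_m)\,g_\lambda\big(y_1,\dots,y_n;\tfrac1{z_1},\tfrac1{z_2},\dots\big)=\prod_{1\le i\le m,\,1\le j\le n}\frac1{1-x_iy_j},$$ summing over all partitions (formal power series identity).
   Context: Lattice conventions: a vertex has left label $a$, bottom $b$, right $c$, top $d$, weight $0$ unless $a+b=c+d$. A row is a sequence of vertices at sites $s=1,2,\dots$, right label at site $s$ = left label at site $s+1$; vertical and horizontal labels are nonnegative integers; the left label at site 1 is free (summed over), the right labels are eventually $0$. Rows $1,\dots,N$ are stacked bottom to top (top labels of row $k$ = bottom labels of row $k+1$), bottom boundary all $0$, top boundary $(m^c_s(\lambda))_{s\ge1}$, $m^c_s(\lambda)=\lambda_s-\lambda_{s+1}$. Partition function = sum over labelings of non-prescribed edges of product of weights. Generalised Grothendieck polynomial $G_\lambda(x_1,\dots,x_m;z_1,\dots,z_m)$: $N=m$, vertex in row $i$, site $s$ has weight $U_{x_i/z_s}$, $U_u(a,b;c,d)=u^a$ if $b=c$, $u^a(1-u)$ if $b>c$, $0$ if $b<c$ (only sites $s\le m$ can carry nonempty vertices, so only $z_1,\dots,z_m$ enter; for $z_s=1$ this is $G^{(0,-1)}_\lambda$). Generalised dual Grothendieck polynomial $g_\lambda(y_1,\dots,y_n;w_1,w_2,\dots)$: $N=n$, vertex in row $i$, site $s$ has weight $(y_i/w_s)^{\min(a,d)}$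 (for $w_s=1$ this is $g^{(0,1)}_\lambda$); in $g_\lambda(y;1/z_1,1/z_2,\dots)$ the weight is $(y_iz_s)^{\min(a,d)}$. -}

module Defs where

import Data.Nat as N

open import Algebra.Bundles using (CommutativeRing)
open import Data.Nat using (ℕ; zero; suc; _≡ᵇ_; _<ᵇ_; _≤ᵇ_; _⊓_)
open import Data.Bool using (Bool; true; false; if_then_else_; _∧_)
open import Data.List using (List; []; _∷_; _++_; [_]; map; concatMap; foldr; upTo; replicate; filterᵇ)
open import Data.Vec as Vec using (Vec)

range : ℕ → List ℕ
range K = upTo (suc K)

tuples : ℕ → ℕ → List (List ℕ)
tuples K zero    = [] ∷ []
tuples K (suc L) = concatMap (λ i → map (i ∷_) (tuples K L)) (range K)

listEqᵇ : List ℕ → List ℕ → Bool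
listEqᵇ []       []       = true
listEqᵇ (a ∷ as) (b ∷ bs) = (a ≡ᵇ b) ∧ listEqᵇ as bs
listEqᵇ _        _        = false

-- Partitions, encoded by their vector  m^c(λ) = (λ_s - λ_{s+1})_{s ≥ 1}
-- (a bijection between partitions and finitely supported ℕ-sequences;
-- λ_s = Σ_{t ≥ s} m^c_t and |λ| = Σ_s s · m^c_s).

wsize : ℕ → List ℕ → ℕ
wsize s []       = 0
wsize s (c ∷ cs) = (s N.* c) N.+ wsize (suc s) cs

size : List ℕ → ℕ
size = wsize 1

-- All partitions λ with |λ| ≤ D, each given by (m^c_s(λ))_{1 ≤ s ≤ D}
-- (for |λ| ≤ D one has m^c_s(λ) = 0 for s > D and m^c_s(λ) ≤ D).
partitionsUpTo : ℕ → List (List ℕ)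
partitionsUpTo D = filterᵇ (λ c → size c ≤ᵇ D) (tuples D D)

module Lattice {c ℓ} (R : CommutativeRing c ℓ) where
  open CommutativeRing R public

  sumL : List Carrier → Carrier
  sumL = foldr _+_ 0#

  prodL : List Carrier → Carrier
  prodL = foldr _*_ 1#

  pow : Carrier → ℕ → Carrier
  pow u zero    = 1#
  pow u (suc k) = u * pow u k

  -- weight of a vertex with labels a (left), b (bottom), c (right), d (top)
  VertexWeight : Set c
  VertexWeight = ℕ → ℕ → ℕ → ℕ → Carrier

  RowWeight : Set c
  RowWeight = ℕ → VertexWeight

  vtx : VertexWeight → VertexWeight
  vtx w a b c d = if ((a N.+ b) ≡ᵇ (c N.+ d)) then w a b c d else 0#

  -- product of the vertex weights of one row, starting at site s;
  -- horizontal labels (left label of site s ∷ right labels of sites s, s+1, ...),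
  -- bottom labels, top labels.
  rowW : RowWeight → ℕ → List ℕ → List ℕ → List ℕ → Carrier
  rowW W s (a ∷ c ∷ hs) (b ∷ bs) (d ∷ ds) = vtx (W s) a b c d * rowW W (suc s) (c ∷ hs) bs ds
  rowW W s _ _ _ = 1#

  -- Sum over all labelings (labels in {0..K}) of sites 1..S of the remaining
  -- rows (listed bottom to top), given the bottom labels of the lowest
  -- remaining row and the prescribed top boundary.  The right label at
  -- site S is 0; the left label at site 1 is summed over.
  partitionFn : (K S : ℕ) → List RowWeight → List ℕ → List ℕ → Carrier
  partitionFn K S []       bottom top = if listEqᵇ bottom top then 1# else 0#
  partitionFn K S (W ∷ Ws) bottom top =
    sumL (concatMap (λ h → map (λ t → rowW W 1 (h ++ [ 0 ]) bottom t * partitionFn K S Ws t top)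
                               (tuples K S))
                    (tuples K S))

  Z : (K S : ℕ) → List RowWeight → List ℕ → Carrier
  Z K S Ws top = partitionFn K S Ws (replicate S 0) top

  U : Carrier → VertexWeight
  U u a b c d = if b ≡ᵇ c then pow u a else (if c <ᵇ b then pow u a * (1# - u) else 0#)

  -- G_λ(x_1..x_m ; z_1,z_2,...) on sites 1..D with labels ≤ D;
  -- zinv s = 1/z_s, row i has weight U_{x_i / z_s} at site s.
  Gλ : (D : ℕ) → {m : ℕ} → Vec Carrier m → (ℕ → Carrier) → List ℕ → Carrier
  Gλ D x zinv top = Z D D (map (λ xi s → U (xi * zinv s)) (Vec.toList x)) top

  -- g_λ(y_1..y_n ; 1/z_1, 1/z_2, ...) : row i, site s has weight (y_i z_s)^min(a,d)
  gλ : (D : ℕ) → {n : ℕ} → Vec Carrier n → (ℕ → Carrier) → List ℕ → Carrier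
  gλ D y z top = Z D D (map (λ yi s a b c d → pow (yi * z s) (a ⊓ d)) (Vec.toList y)) top

  monomial : {m : ℕ} → Vec Carrier m → Vec ℕ m → Carrier
  monomial x α = Vec.foldr _ _*_ 1# (Vec.zipWith pow x α)

  -- truncated geometric series Σ_{k=0}^{D} u^k  (= 1/(1-u) modulo degree > D)
  geom : ℕ → Carrier → Carrier
  geom D u = sumL (map (pow u) (range D))

  cauchyRHS : (D : ℕ) → {m n : ℕ} → Vec Carrier m → Vec Carrier n → Carrier
  cauchyRHS D x y = prodL (concatMap (λ xi → map (λ yj → geom D (xi * yj)) (Vec.toList y)) (Vec.toList x))

  cauchyLHS : (D : ℕ) → {m n : ℕ} → Vec Carrier m → Vec Carrier n → (z zinv : ℕ → Carrier) → Carrier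
  cauchyLHS D x y z zinv = sumL (map (λ lam → Gλ D x zinv lam * gλ D y z lam) (partitionsUpTo D))

{-# OPTIONS --safe #-}
module Submission where

-- Let G_x(μ → λ) and g_y(μ → λ) be the one-row transfer weights.  Writing a row in terms of the parts
-- of λ instead of its labels, the sums over λ and ρ in the skew Cauchy identity
--   Σ_λ G_x(μ → λ) g_y(κ → λ) = 1/(1 − x y) · Σ_ρ G_x(ρ → κ) g_y(ρ → μ)
-- decouple into independent one-dimensional sums.  The sum over λ_{s+1} on the left matches the sum
-- over ρ_s on the right (both are the telescoping sum Φ below), and the sum over the unbounded part
-- λ_1 gives the factor 1/(1 − x y).  Since 0 is the only partition contained in 0, the identity makes
-- (G_λ)_λ an eigenvector of g_y, with eigenvalue Π_i 1/(1 − x_i y); pairing it with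
-- g_{y_n} ⋯ g_{y_1} gives the theorem.
--
-- The truncation at sites, labels and sizes at most D is harmless because G_x(μ → λ) is divisible by
-- x^{|λ| − |μ|}.

open import Defs
open import Algebra.Bundles using (CommutativeRing)
import Algebra.Solver.CommutativeMonoid as CommutativeMonoidSolver
open import Data.Bool as Bool using (Bool; true; false; if_then_else_)
open import Data.Empty using (⊥-elim)
open import Data.List as List using (List; []; _∷_; _++_; [_]; map; concatMap; filterᵇ; applyUpTo)
open import Data.List.Membership.Propositional using (_∈_)
open import Data.List.Membership.Propositional.Properties using (∈-upTo⁻)
open import Data.List.Properties using (map-upTo; map-∘)
open import Data.List.Relation.Unary.All as ListAll using ([]; _∷_)
open import Data.List.Relation.Unary.Any using (here; there)
open import Data.Nat as N using (ℕ; zero; suc; _≤_; _<_; _∸_; _⊓_; _≡ᵇ_; _<ᵇ_; _≤ᵇ_; z≤n; s≤s)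
open import Data.Nat.Properties as NP using ()
open import Data.Nat.Tactic.RingSolver using (solve-∀)
open import Data.Product using (∃; _×_; _,_; proj₁; proj₂)
open import Data.Sum using (_⊎_; inj₁; inj₂)
open import Data.Vec using (Vec; []; _∷_; toList; sum; replicate)
open import Data.Vec.Properties using (≡-dec)
open import Data.Vec.Relation.Unary.All using (All; []; _∷_)
open import Function using (_∘_)
open import Relation.Binary.PropositionalEquality as ≡ using (_≡_; _≢_)
import Relation.Binary.Reasoning.Setoid as SetoidReasoning
open import Relation.Nullary using (¬_; yes; no)

-- The power series identity is read in any commutative ring in which the monomials of degree D + 1
-- in `x` vanish. Such a ring carries no grading, so "only terms of high degree" is replaced by
-- annihilation by monomials (`Ord`), and the skew identity is proved after multiplication by an
-- element `r` of known order, which stands for the rows of G already traversed. This factor cannot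
-- be dropped: on D sites every λ with more than D parts is missing. Interlacing λ_{D+1} ≤ μ_D
-- forces |μ| ≥ D and |λ| > D for such λ, so `r` times the missing weight is zero. The decoupling
-- rests on the minimum in the weight of g: in a row from κ to λ, min(λ_s - κ_s, λ_s - λ_{s+1}) =
-- λ_s - max(κ_s, λ_{s+1}), hence λ_s and λ_{s+1} enter through separate factors. Since the
-- parameters of the two rows multiply to x y at every site, the dependence on λ_s becomes a power
-- of x y. Only this power travels from site to site, and the induction runs leftwards from the last
-- site.

-- Finite sums in a commutative ring.

module FiniteSums {c ℓ} (R : CommutativeRing c ℓ) where
  open Lattice R
  open SetoidReasoning setoid
  open CommutativeMonoidSolver +-commutativeMonoid using (solve; _⊕_; _⊜_)

  opaque
    ∑ : ∀ {a} {A : Set a} → List A → (A → Carrier) → Carrier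
    ∑ xs f = sumL (map f xs)

    sumL-map : ∀ {a} {A : Set a} (xs : List A) (f : A → Carrier) → sumL (map f xs) ≈ ∑ xs f
    sumL-map xs f = refl

    ∑-[] : ∀ {a} {A : Set a} (f : A → Carrier) → ∑ [] f ≈ 0#
    ∑-[] f = refl

    ∑-∷ : ∀ {a} {A : Set a} x xs (f : A → Carrier) → ∑ (x ∷ xs) f ≈ f x + ∑ xs f
    ∑-∷ x xs f = refl

  module _ {a} {A : Set a} where

    opaque
      unfolding ∑

      ∑-cong-∈ : ∀ xs {f g : A → Carrier} → (∀ x → x ∈ xs → f x ≈ g x) → ∑ xs f ≈ ∑ xs g
      ∑-cong-∈ []       h = refl
      ∑-cong-∈ (x ∷ xs) h = +-cong (h x (here ≡.refl)) (∑-cong-∈ xs λ y y∈ → h y (there y∈))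

      ∑-cong : ∀ xs {f g : A → Carrier} → (∀ x → f x ≈ g x) → ∑ xs f ≈ ∑ xs g
      ∑-cong xs h = ∑-cong-∈ xs λ x _ → h x

      ∑-0 : ∀ (xs : List A) → ∑ xs (λ _ → 0#) ≈ 0#
      ∑-0 []       = refl
      ∑-0 (x ∷ xs) = trans (+-identityˡ _) (∑-0 xs)

      ∑-zero : ∀ xs {f : A → Carrier} → (∀ x → f x ≈ 0#) → ∑ xs f ≈ 0#
      ∑-zero xs h = trans (∑-cong xs h) (∑-0 xs)

      ∑-+ : ∀ xs (f g : A → Carrier) → ∑ xs (λ x → f x + g x) ≈ ∑ xs f + ∑ xs g
      ∑-+ []       f g = sym (+-identityˡ 0#)
      ∑-+ (x ∷ xs) f g = trans (+-congˡ (∑-+ xs f g))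
        (solve 4 (λ p q r s → (p ⊕ q) ⊕ (r ⊕ s) ⊜ (p ⊕ r) ⊕ (q ⊕ s)) refl _ _ _ _)

      *-∑ : ∀ k xs (f : A → Carrier) → k * ∑ xs f ≈ ∑ xs (λ x → k * f x)
      *-∑ k []       f = zeroʳ k
      *-∑ k (x ∷ xs) f = trans (distribˡ k _ _) (+-congˡ (*-∑ k xs f))

      ∑-* : ∀ k xs (f : A → Carrier) → ∑ xs f * k ≈ ∑ xs (λ x → f x * k)
      ∑-* k []       f = zeroˡ k
      ∑-* k (x ∷ xs) f = trans (distribʳ k _ _) (+-congˡ (∑-* k xs f))

      ∑-++ : ∀ xs ys (f : A → Carrier) → ∑ (xs ++ ys) f ≈ ∑ xs f + ∑ ys f
      ∑-++ []       ys f = sym (+-identityˡ _)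
      ∑-++ (x ∷ xs) ys f = trans (+-congˡ (∑-++ xs ys f)) (sym (+-assoc _ _ _))

      ∑-filter : ∀ (p : A → Bool) xs (f : A → Carrier) →
        ∑ (filterᵇ p xs) f ≈ ∑ xs (λ x → if p x then f x else 0#)
      ∑-filter p []       f = refl
      ∑-filter p (x ∷ xs) f with p x
      ... | true  = +-congˡ (∑-filter p xs f)
      ... | false = trans (∑-filter p xs f) (sym (+-identityˡ _))

  module _ {a b} {A : Set a} {B : Set b} where

    opaque
      unfolding ∑

      ∑-swap : ∀ xs ys (f : A → B → Carrier) →
        ∑ xs (λ x → ∑ ys (f x)) ≈ ∑ ys (λ y → ∑ xs (λ x → f x y))
      ∑-swap []       ys f = sym (∑-0 ys)
      ∑-swap (x ∷ xs) ys f = trans (+-congˡ (∑-swap xs ys f)) (sym (∑-+ ys _ _))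

      ∑-*-∑ : ∀ xs ys (f : A → Carrier) (g : B → Carrier) →
        ∑ xs f * ∑ ys g ≈ ∑ xs (λ x → ∑ ys (λ y → f x * g y))
      ∑-*-∑ xs ys f g = trans (∑-* _ xs f) (∑-cong xs λ x → *-∑ _ ys g)

      ∑-map : ∀ (g : A → B) xs (f : B → Carrier) → ∑ (map g xs) f ≈ ∑ xs (f ∘ g)
      ∑-map g xs f = reflexive (≡.cong sumL (≡.sym (map-∘ xs)))

      ∑-concatMap : ∀ (g : A → List B) xs (f : B → Carrier) →
        ∑ (concatMap g xs) f ≈ ∑ xs (λ x → ∑ (g x) f)
      ∑-concatMap g []       f = refl
      ∑-concatMap g (x ∷ xs) f = trans (∑-++ (g x) _ f) (+-congˡ (∑-concatMap g xs f))

  private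
    below : ℕ → (ℕ → Carrier) → Carrier
    below n f = sumL (applyUpTo f n)

    ∑-range : ∀ K f → ∑ (range K) f ≈ below (suc K) f
    ∑-range K f = trans (sym (sumL-map (range K) f)) (reflexive (≡.cong sumL (map-upTo f (suc K))))

    below-zero : ∀ n f → (∀ i → i < n → f i ≈ 0#) → below n f ≈ 0#
    below-zero zero    f h = refl
    below-zero (suc n) f h = trans (+-cong (h 0 (s≤s z≤n)) (below-zero n (f ∘ suc) λ i i<n → h (suc i) (s≤s i<n)))
                                   (+-identityˡ 0#)

    below-+ : ∀ m n f → below (m N.+ n) f ≈ below m f + below n (λ i → f (m N.+ i))
    below-+ zero    n f = sym (+-identityˡ _)
    below-+ (suc m) n f = trans (+-congˡ (below-+ m n (f ∘ suc))) (sym (+-assoc _ _ _))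

  ∈-range⇒≤ : ∀ {K i} → i ∈ range K → i ≤ K
  ∈-range⇒≤ i∈ = NP.≤-pred (∈-upTo⁻ i∈)

  ∑-range-suc : ∀ K f → ∑ (range (suc K)) f ≈ f 0 + ∑ (range K) (f ∘ suc)
  ∑-range-suc K f = trans (∑-range (suc K) f) (+-congˡ (sym (∑-range K (f ∘ suc))))

  -- Interlacing confines a label to an interval; this replaces the label by its excess `j` over the
  -- least admissible value.
  ∑-window : ∀ {K} C B f → C N.+ B ≤ K →
    (∀ i → i ≤ K → i < C ⊎ C N.+ B < i → f i ≈ 0#) →
    ∑ (range K) f ≈ ∑ (range B) (λ j → f (C N.+ j))
  ∑-window {K} C B f C+B≤K h with NP.m≤n⇒∃[o]m+o≡n C+B≤K
  ... | o , ≡.refl = begin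
    ∑ (range (C N.+ B N.+ o)) f
      ≈⟨ ∑-range (C N.+ B N.+ o) f ⟩
    below (suc (C N.+ B N.+ o)) f
      ≡⟨ ≡.cong (λ n → below n f) (≡.trans (≡.cong suc (NP.+-assoc C B o)) (≡.sym (NP.+-suc C (B N.+ o)))) ⟩
    below (C N.+ (suc B N.+ o)) f
      ≈⟨ below-+ C _ f ⟩
    below C f + below (suc B N.+ o) (λ i → f (C N.+ i))
      ≈⟨ +-cong (below-zero C f λ i i<C → h i (NP.≤-trans (NP.<⇒≤ i<C) (NP.≤-trans (NP.m≤m+n C B) C+B≤K)) (inj₁ i<C))
                (below-+ (suc B) o λ i → f (C N.+ i)) ⟩
    0# + (below (suc B) (λ i → f (C N.+ i)) + below o (λ i → f (C N.+ (suc B N.+ i))))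
      ≈⟨ +-identityˡ _ ⟩
    below (suc B) (λ i → f (C N.+ i)) + below o (λ i → f (C N.+ (suc B N.+ i)))
      ≈⟨ +-congˡ (below-zero o _ λ i i<o → h (C N.+ (suc B N.+ i)) (le i i<o) (inj₂ (lt i))) ⟩
    below (suc B) (λ i → f (C N.+ i)) + 0#
      ≈⟨ +-identityʳ _ ⟩
    below (suc B) (λ i → f (C N.+ i))
      ≈⟨ sym (∑-range B _) ⟩
    ∑ (range B) (λ j → f (C N.+ j)) ∎
    where
    shift : ∀ i → C N.+ (suc B N.+ i) ≡ C N.+ B N.+ suc i
    shift i = ≡.trans (≡.cong (C N.+_) (≡.sym (NP.+-suc B i))) (≡.sym (NP.+-assoc C B (suc i)))
    le : ∀ i → i < o → C N.+ (suc B N.+ i) ≤ C N.+ B N.+ o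
    le i i<o = ≡.subst (_≤ C N.+ B N.+ o) (≡.sym (shift i)) (NP.+-monoʳ-≤ (C N.+ B) i<o)
    lt : ∀ i → C N.+ B < C N.+ (suc B N.+ i)
    lt i = ≡.subst (C N.+ B <_) (≡.sym (shift i)) (NP.m<m+n (C N.+ B) (s≤s z≤n))

  ∑-range-single : ∀ {K} i₀ f → i₀ ≤ K → (∀ i → i ≢ i₀ → f i ≈ 0#) → ∑ (range K) f ≈ f i₀
  ∑-range-single {K} i₀ f i₀≤K h = begin
    ∑ (range K) f                    ≈⟨ ∑-window i₀ 0 f (≡.subst (_≤ K) i₀≡ i₀≤K) out ⟩
    ∑ (range 0) (λ j → f (i₀ N.+ j)) ≈⟨ trans (∑-∷ 0 [] _) (trans (+-congˡ (∑-[] _)) (+-identityʳ _)) ⟩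
    f (i₀ N.+ 0)                     ≡⟨ ≡.cong f (≡.sym i₀≡) ⟩
    f i₀                             ∎
    where
    i₀≡ : i₀ ≡ i₀ N.+ 0
    i₀≡ = ≡.sym (NP.+-identityʳ i₀)
    out : ∀ i → i ≤ K → i < i₀ ⊎ i₀ N.+ 0 < i → f i ≈ 0#
    out i _ (inj₁ i<) = h i (NP.<⇒≢ i<)
    out i _ (inj₂ <i) = h i (NP.>⇒≢ (≡.subst (_< i) (≡.sym i₀≡) <i))

≡ᵇ-true : ∀ {m n} → m ≡ n → (m ≡ᵇ n) ≡ true
≡ᵇ-true {m} ≡.refl = n≡ᵇn m
  where
  n≡ᵇn : ∀ n → (n ≡ᵇ n) ≡ true
  n≡ᵇn zero    = ≡.refl
  n≡ᵇn (suc n) = n≡ᵇn n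

≡ᵇ-false : ∀ {m n} → m ≢ n → (m ≡ᵇ n) ≡ false
≡ᵇ-false {m} {n} m≢n with m ≡ᵇ n in eq
... | false = ≡.refl
... | true  = ⊥-elim (m≢n (NP.≡ᵇ⇒≡ m n (≡.subst Bool.T (≡.sym eq) _)))

sum≡0⇒replicate : ∀ {S} (v : Vec ℕ S) → sum v ≡ 0 → v ≡ replicate S 0
sum≡0⇒replicate []         _  = ≡.refl
sum≡0⇒replicate (zero ∷ v) eq = ≡.cong (0 ∷_) (sum≡0⇒replicate v eq)

sum-replicate-0 : ∀ S → sum (replicate S 0) ≡ 0
sum-replicate-0 zero    = ≡.refl
sum-replicate-0 (suc S) = sum-replicate-0 S

toList-replicate : ∀ S → List.replicate S 0 ≡ toList (replicate S 0)
toList-replicate zero    = ≡.refl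
toList-replicate (suc S) = ≡.cong (0 ∷_) (toList-replicate S)

All-replicate-0 : ∀ K S → All (_≤ K) (replicate S 0)
All-replicate-0 K zero    = []
All-replicate-0 K (suc S) = z≤n ∷ All-replicate-0 K S

balance : ∀ a b c d {m n} → a N.+ b ≡ c N.+ d → c N.+ m ≡ n → a N.+ (b N.+ m) ≡ d N.+ n
balance a b c d {m} {n} eq eq′ = begin
  a N.+ (b N.+ m) ≡⟨ ≡.sym (NP.+-assoc a b m) ⟩
  a N.+ b N.+ m   ≡⟨ ≡.cong (N._+ m) (≡.trans eq (NP.+-comm c d)) ⟩
  d N.+ c N.+ m   ≡⟨ NP.+-assoc d c m ⟩
  d N.+ (c N.+ m) ≡⟨ ≡.cong (d N.+_) eq′ ⟩
  d N.+ n         ∎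
  where open ≡.≡-Reasoning

-- One-row transfer weights and their iteration.

module Transfer {c ℓ} (R : CommutativeRing c ℓ) (K : ℕ) where
  open Lattice R
  open FiniteSums R
  open SetoidReasoning setoid

  states : ∀ S → List (Vec ℕ S)
  states zero    = [] ∷ []
  states (suc S) = concatMap (λ i → map (i ∷_) (states S)) (range K)

  ∑-singleton : ∀ {a} {A : Set a} (x : A) f → ∑ (x ∷ []) f ≈ f x
  ∑-singleton x f = trans (∑-∷ x [] f) (trans (+-congˡ (∑-[] f)) (+-identityʳ _))

  ∑-states-suc : ∀ S (f : Vec ℕ (suc S) → Carrier) →
    ∑ (states (suc S)) f ≈ ∑ (range K) (λ i → ∑ (states S) (λ v → f (i ∷ v)))
  ∑-states-suc S f = trans (∑-concatMap _ (range K) f) (∑-cong (range K) λ i → ∑-map (i ∷_) (states S) f)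

  ∑-tuples : ∀ S f → ∑ (tuples K S) f ≈ ∑ (states S) (λ v → f (toList v))
  ∑-tuples zero    f = trans (∑-singleton [] f) (sym (∑-singleton [] (λ v → f (toList v))))
  ∑-tuples (suc S) f = begin
    ∑ (tuples K (suc S)) f
      ≈⟨ ∑-concatMap _ (range K) f ⟩
    ∑ (range K) (λ i → ∑ (map (i ∷_) (tuples K S)) f)
      ≈⟨ ∑-cong (range K) (λ i → trans (∑-map (i ∷_) (tuples K S) f) (∑-tuples S (λ t → f (i ∷ t)))) ⟩
    ∑ (range K) (λ i → ∑ (states S) (λ v → f (i ∷ toList v)))
      ≈⟨ sym (∑-states-suc S _) ⟩
    ∑ (states (suc S)) (λ v → f (toList v)) ∎

  ∑-states-cong : ∀ S {f g : Vec ℕ S → Carrier} → (∀ v → All (_≤ K) v → f v ≈ g v) →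
    ∑ (states S) f ≈ ∑ (states S) g
  ∑-states-cong zero    h = trans (∑-singleton [] _) (trans (h [] []) (sym (∑-singleton [] _)))
  ∑-states-cong (suc S) h = trans (∑-states-suc S _) (trans
    (∑-cong-∈ (range K) λ i i∈ → ∑-states-cong S λ v v≤ → h (i ∷ v) (∈-range⇒≤ i∈ ∷ v≤))
    (sym (∑-states-suc S _)))

  ∑-states-single : ∀ {S} {v₀ : Vec ℕ S} → All (_≤ K) v₀ → ∀ f → (∀ v → v ≢ v₀ → f v ≈ 0#) →
    ∑ (states S) f ≈ f v₀
  ∑-states-single []         f h = ∑-singleton [] f
  ∑-states-single {suc S} {i₀ ∷ v₀} (i₀≤ ∷ v₀≤) f h = begin
    ∑ (states (suc S)) f
      ≈⟨ ∑-states-suc S f ⟩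
    ∑ (range K) (λ i → ∑ (states S) (λ v → f (i ∷ v)))
      ≈⟨ ∑-range-single i₀ _ i₀≤ (λ i i≢ → ∑-zero (states S) λ v → h (i ∷ v) λ { ≡.refl → i≢ ≡.refl }) ⟩
    ∑ (states S) (λ v → f (i₀ ∷ v))
      ≈⟨ ∑-states-single v₀≤ (λ v → f (i₀ ∷ v)) (λ v v≢ → h (i₀ ∷ v) λ { ≡.refl → v≢ ≡.refl }) ⟩
    f (i₀ ∷ v₀) ∎

  vtx-≡ : ∀ w a b c d → a N.+ b ≡ c N.+ d → vtx w a b c d ≈ w a b c d
  vtx-≡ w a b c d eq = reflexive (≡.cong (if_then w a b c d else 0#) (≡ᵇ-true eq))

  vtx-≢ : ∀ w a b c d → a N.+ b ≢ c N.+ d → vtx w a b c d ≈ 0#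
  vtx-≢ w a b c d neq = reflexive (≡.cong (if_then w a b c d else 0#) (≡ᵇ-false neq))

  -- The partition function of a single row whose leftmost horizontal label is fixed to a.
  row : ∀ {S} → RowWeight → ℕ → ℕ → Vec ℕ S → Vec ℕ S → Carrier
  row W s a []       []       = if a ≡ᵇ 0 then 1# else 0#
  row W s a (b ∷ bs) (d ∷ ds) = ∑ (range K) λ c → vtx (W s) a b c d * row W (suc s) c bs ds

  transfer : ∀ {S} → RowWeight → Vec ℕ S → Vec ℕ S → Carrier
  transfer W bs ds = ∑ (range K) λ a → row W 1 a bs ds

  evolve : ∀ {S} → List RowWeight → Vec ℕ S → Vec ℕ S → Carrier
  evolve []       b t = if listEqᵇ (toList b) (toList t) then 1# else 0#
  evolve {S} (W ∷ Ws) b t = ∑ (states S) λ v → transfer W b v * evolve Ws v t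

  private
    hd : List ℕ → ℕ
    -- Past the last site the next horizontal label is the right boundary label 0.
    hd []      = 0
    hd (a ∷ _) = a

    rowW-∷ : ∀ W s a h b bs d ds → rowW W s (a ∷ (h ++ [ 0 ])) (b ∷ bs) (d ∷ ds)
           ≈ vtx (W s) a b (hd h) d * rowW W (suc s) (h ++ [ 0 ]) bs ds
    rowW-∷ W s a []      b bs d ds = refl
    rowW-∷ W s a (c ∷ h) b bs d ds = refl

    -- The weight φ of the leftmost label stands for the vertex immediately to the left.
    ∑-rowW : ∀ {S} W s (φ : ℕ → Carrier) (bs ds : Vec ℕ S) →
      ∑ (tuples K S) (λ h → φ (hd h) * rowW W s (h ++ [ 0 ]) (toList bs) (toList ds))
      ≈ ∑ (range K) (λ a → φ a * row W s a bs ds)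
    ∑-rowW W s φ [] [] = trans (∑-singleton [] _) (sym (∑-range-single 0 _ z≤n off))
      where
      off : ∀ i → i ≢ 0 → φ i * row W s i [] [] ≈ 0#
      off zero    i≢0 = ⊥-elim (i≢0 ≡.refl)
      off (suc i) _   = zeroʳ _
    ∑-rowW {suc S} W s φ (b ∷ bs) (d ∷ ds) = begin
      ∑ (tuples K (suc S)) (λ h → φ (hd h) * rowW W s (h ++ [ 0 ]) (b ∷ toList bs) (d ∷ toList ds))
        ≈⟨ trans (∑-concatMap _ (range K) _) (∑-cong (range K) λ a → ∑-map (a ∷_) (tuples K S) _) ⟩
      ∑ (range K) (λ a → ∑ (tuples K S) λ h → φ a * rowW W s (a ∷ (h ++ [ 0 ])) (b ∷ toList bs) (d ∷ toList ds))
        ≈⟨ ∑-cong (range K) (λ a → sym (*-∑ (φ a) (tuples K S) _)) ⟩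
      ∑ (range K) (λ a → φ a * ∑ (tuples K S) λ h → rowW W s (a ∷ (h ++ [ 0 ])) (b ∷ toList bs) (d ∷ toList ds))
        ≈⟨ ∑-cong (range K) (λ a → *-congˡ (trans (∑-cong (tuples K S) λ h → rowW-∷ W s a h b (toList bs) d (toList ds))
             (∑-rowW W (suc s) (λ c → vtx (W s) a b c d) bs ds))) ⟩
      ∑ (range K) (λ a → φ a * row W s a (b ∷ bs) (d ∷ ds)) ∎

  ∑-rowW≈transfer : ∀ {S} W (bs ds : Vec ℕ S) →
    ∑ (tuples K S) (λ h → rowW W 1 (h ++ [ 0 ]) (toList bs) (toList ds)) ≈ transfer W bs ds
  ∑-rowW≈transfer {S} W bs ds = trans (∑-cong (tuples K S) λ h → sym (*-identityˡ _))
    (trans (∑-rowW W 1 (λ _ → 1#) bs ds) (∑-cong (range K) λ a → *-identityˡ _))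

  sumL-concatMap : ∀ {a b} {A : Set a} {B : Set b} (f : A → B → Carrier) xs ys →
    sumL (concatMap (λ x → map (f x) ys) xs) ≈ ∑ xs (λ x → ∑ ys (f x))
  sumL-concatMap f []       ys = sym (∑-[] _)
  sumL-concatMap f (x ∷ xs) ys = begin
    sumL (map (f x) ys ++ concatMap (λ x → map (f x) ys) xs)
      ≈⟨ sumL-++ (map (f x) ys) _ ⟩
    sumL (map (f x) ys) + sumL (concatMap (λ x → map (f x) ys) xs)
      ≈⟨ +-cong (sumL-map ys (f x)) (sumL-concatMap f xs ys) ⟩
    ∑ ys (f x) + ∑ xs (λ x → ∑ ys (f x))
      ≈⟨ sym (∑-∷ x xs _) ⟩
    ∑ (x ∷ xs) (λ x → ∑ ys (f x)) ∎
    where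
    sumL-++ : ∀ us vs → sumL (us ++ vs) ≈ sumL us + sumL vs
    sumL-++ []       vs = sym (+-identityˡ _)
    sumL-++ (u ∷ us) vs = trans (+-congˡ (sumL-++ us vs)) (sym (+-assoc _ _ _))

  partitionFn≈evolve : ∀ {S} Ws (b t : Vec ℕ S) → partitionFn K S Ws (toList b) (toList t) ≈ evolve Ws b t
  partitionFn≈evolve []       b t = refl
  partitionFn≈evolve {S} (W ∷ Ws) b t = begin
    partitionFn K S (W ∷ Ws) (toList b) (toList t)
      ≈⟨ sumL-concatMap _ (tuples K S) (tuples K S) ⟩
    ∑ (tuples K S) (λ h → ∑ (tuples K S) λ v → rowW W 1 (h ++ [ 0 ]) (toList b) v * partitionFn K S Ws v (toList t))
      ≈⟨ ∑-swap (tuples K S) (tuples K S) _ ⟩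
    ∑ (tuples K S) (λ v → ∑ (tuples K S) λ h → rowW W 1 (h ++ [ 0 ]) (toList b) v * partitionFn K S Ws v (toList t))
      ≈⟨ ∑-tuples S _ ⟩
    ∑ (states S) (λ v → ∑ (tuples K S) λ h → rowW W 1 (h ++ [ 0 ]) (toList b) (toList v) * partitionFn K S Ws (toList v) (toList t))
      ≈⟨ ∑-cong (states S) (λ v → trans (sym (∑-* _ (tuples K S) _))
           (*-cong (∑-rowW≈transfer W b v) (partitionFn≈evolve Ws v t))) ⟩
    ∑ (states S) (λ v → transfer W b v * evolve Ws v t) ∎

  Z≈evolve : ∀ {S} Ws (t : Vec ℕ S) → Z K S Ws (toList t) ≈ evolve Ws (replicate S 0) t
  Z≈evolve {S} Ws t = trans (reflexive (≡.cong (λ b → partitionFn K S Ws b (toList t)) (toList-replicate S)))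
                            (partitionFn≈evolve Ws (replicate S 0) t)

  evolve-[]-refl : ∀ {S} (b : Vec ℕ S) → evolve [] b b ≈ 1#
  evolve-[]-refl b = reflexive (≡.cong (if_then 1# else 0#) (listEqᵇ-refl (toList b)))
    where
    listEqᵇ-refl : ∀ xs → listEqᵇ xs xs ≡ true
    listEqᵇ-refl []       = ≡.refl
    listEqᵇ-refl (x ∷ xs) rewrite ≡ᵇ-true {x} ≡.refl = listEqᵇ-refl xs

  evolve-[]-≢ : ∀ {S} {b t : Vec ℕ S} → b ≢ t → evolve [] b t ≈ 0#
  evolve-[]-≢ {b = b} {t} b≢t = reflexive (≡.cong (if_then 1# else 0#) (listEqᵇ-≢ b t b≢t))
    where
    listEqᵇ-≢ : ∀ {S} (b t : Vec ℕ S) → b ≢ t → listEqᵇ (toList b) (toList t) ≡ false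
    listEqᵇ-≢ []      []      neq = ⊥-elim (neq ≡.refl)
    listEqᵇ-≢ (x ∷ b) (y ∷ t) neq with x N.≟ y
    ... | no  x≢y    rewrite ≡ᵇ-false x≢y = ≡.refl
    ... | yes ≡.refl rewrite ≡ᵇ-true {x} ≡.refl = listEqᵇ-≢ b t λ { ≡.refl → neq ≡.refl }

  -- Conservation at the vertices telescopes along the row, whose last right label is 0. The labels
  -- from a site onwards sum to the part of the partition at that site, so the left label is the
  -- growth of this part.
  row-≢ : ∀ {S} W s a (bs ds : Vec ℕ S) → a N.+ sum bs ≢ sum ds → row W s a bs ds ≈ 0#
  row-≢ W s zero    []       []       neq = ⊥-elim (neq ≡.refl)
  row-≢ W s (suc a) []       []       neq = refl
  row-≢ W s a       (b ∷ bs) (d ∷ ds) neq = ∑-zero (range K) term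
    where
    term : ∀ c → vtx (W s) a b c d * row W (suc s) c bs ds ≈ 0#
    term c with (a N.+ b) N.≟ (c N.+ d)
    ... | no  neq′ = trans (*-congʳ (vtx-≢ (W s) a b c d neq′)) (zeroˡ _)
    ... | yes eq   = trans (*-congˡ (row-≢ W (suc s) c bs ds λ eq′ → neq (balance a b c d eq eq′))) (zeroʳ _)

  module Vacuum (W : RowWeight) (W-0 : ∀ s → W s 0 0 0 0 ≈ 1#) where

    row-0 : ∀ S s → row W s 0 (replicate S 0) (replicate S 0) ≈ 1#
    row-0 zero    s = refl
    row-0 (suc S) s = begin
      ∑ (range K) (λ c → vtx (W s) 0 0 c 0 * row W (suc s) c (replicate S 0) (replicate S 0))
        ≈⟨ ∑-range-single 0 _ z≤n (λ c c≢0 → trans (*-congˡ (row-≢ W (suc s) c (replicate S 0) (replicate S 0) λ eq → c≢0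
             (NP.m+n≡0⇒m≡0 c (≡.trans eq (sum-replicate-0 S))))) (zeroʳ _)) ⟩
      W s 0 0 0 0 * row W (suc s) 0 (replicate S 0) (replicate S 0)
        ≈⟨ *-cong (W-0 s) (row-0 S (suc s)) ⟩
      1# * 1#
        ≈⟨ *-identityˡ 1# ⟩
      1# ∎

    transfer-0 : ∀ S → transfer W (replicate S 0) (replicate S 0) ≈ 1#
    transfer-0 S = trans
      (∑-range-single 0 _ z≤n λ a a≢0 → row-≢ W 1 a (replicate S 0) (replicate S 0) λ eq → a≢0 (NP.m+n≡0⇒m≡0 a (≡.trans eq (sum-replicate-0 S))))
      (row-0 S 1)

    transfer-≢0 : ∀ {S} {b : Vec ℕ S} → b ≢ replicate S 0 → transfer W b (replicate S 0) ≈ 0#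
    transfer-≢0 {S} {b} b≢0 = ∑-zero (range K) λ a → row-≢ W 1 a b (replicate S 0) λ eq →
      b≢0 (sum≡0⇒replicate b (NP.m+n≡0⇒n≡0 a (≡.trans eq (sum-replicate-0 S))))

  -- A row never decreases the sum of the labels, so the empty partition is reached only from
  -- itself, through empty vertices.
  evolve-vacuum : ∀ {S} Ws → ListAll.All (λ W → ∀ s → W s 0 0 0 0 ≈ 1#) Ws →
    evolve Ws (replicate S 0) (replicate S 0) ≈ 1# × (∀ {b : Vec ℕ S} → b ≢ replicate S 0 → evolve Ws b (replicate S 0) ≈ 0#)
  evolve-vacuum {S} []       _            = evolve-[]-refl (replicate S 0) , evolve-[]-≢
  evolve-vacuum {S} (W ∷ Ws) (W-0 ∷ Ws-0) =
      trans (onlyVacuum (replicate S 0)) (trans (*-cong (transfer-0 S) (proj₁ ih)) (*-identityˡ 1#))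
    , λ {b} b≢0 → trans (onlyVacuum b) (trans (*-congʳ (transfer-≢0 b≢0)) (zeroˡ _))
    where
    open Vacuum W W-0
    ih = evolve-vacuum Ws Ws-0
    onlyVacuum : ∀ b → evolve (W ∷ Ws) b (replicate S 0) ≈ transfer W b (replicate S 0) * evolve Ws (replicate S 0) (replicate S 0)
    onlyVacuum b = ∑-states-single (All-replicate-0 K S) _ λ v v≢0 → trans (*-congˡ (proj₂ ih v≢0)) (zeroʳ _)

-- Arithmetic of the exponents.

-- Both sides are max(M, N).
∸-balance : ∀ M N → (M ∸ N) N.+ N ≡ (N ∸ M) N.+ M
∸-balance zero    N       rewrite NP.0∸n≡0 N = ≡.sym (NP.+-identityʳ N)
∸-balance (suc M) zero    = NP.+-identityʳ (suc M)
∸-balance (suc M) (suc N) = begin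
  (M ∸ N) N.+ suc N ≡⟨ NP.+-suc (M ∸ N) N ⟩
  suc ((M ∸ N) N.+ N) ≡⟨ ≡.cong suc (∸-balance M N) ⟩
  suc ((N ∸ M) N.+ M) ≡⟨ ≡.sym (NP.+-suc (N ∸ M) M) ⟩
  (N ∸ M) N.+ suc M ∎
  where open ≡.≡-Reasoning

∸-disjoint : ∀ M N → N ∸ M ≡ 0 ⊎ M ∸ N ≡ 0
∸-disjoint M N with NP.≤-total M N
... | inj₁ M≤N = inj₂ (NP.m≤n⇒m∸n≡0 M≤N)
... | inj₂ N≤M = inj₁ (NP.m≤n⇒m∸n≡0 N≤M)

-- For a row from κ to λ, `A′ + i` is λ_s - κ_s and `A + i + o` is λ_s - λ_{s+1}, so the minimum is
-- λ_s - max(κ_s, λ_{s+1}). Splitting off `i` removes λ_s from what remains.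
min-shiftˡ : ∀ {A A′} → A ≡ 0 ⊎ A′ ≡ 0 → ∀ i j o →
  (A′ N.+ i) ⊓ (A N.+ i N.+ o) N.+ j ≡ i N.+ ((A′ N.+ j) ⊓ (j N.+ o))
min-shiftˡ {_} {A′} (inj₁ ≡.refl) i j o = begin
  (A′ N.+ i) ⊓ (i N.+ o) N.+ j     ≡⟨ ≡.cong (λ t → t ⊓ (i N.+ o) N.+ j) (NP.+-comm A′ i) ⟩
  (i N.+ A′) ⊓ (i N.+ o) N.+ j     ≡⟨ ≡.cong (N._+ j) (≡.sym (NP.+-distribˡ-⊓ i A′ o)) ⟩
  i N.+ (A′ ⊓ o) N.+ j             ≡⟨ NP.+-assoc i _ j ⟩
  i N.+ ((A′ ⊓ o) N.+ j)           ≡⟨ ≡.cong (i N.+_) (NP.+-distribʳ-⊓ j A′ o) ⟩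
  i N.+ ((A′ N.+ j) ⊓ (o N.+ j))   ≡⟨ ≡.cong (λ t → i N.+ ((A′ N.+ j) ⊓ t)) (NP.+-comm o j) ⟩
  i N.+ ((A′ N.+ j) ⊓ (j N.+ o))   ∎
  where open ≡.≡-Reasoning
min-shiftˡ {A} (inj₂ ≡.refl) i j o = ≡.cong₂ N._+_
  (NP.m≤n⇒m⊓n≡m (NP.≤-trans (NP.m≤n+m i A) (NP.m≤m+n (A N.+ i) o)))
  (≡.sym (NP.m≤n⇒m⊓n≡m (NP.m≤m+n j o)))

-- If `C′` is zero, then `A′ + j ≤ A′ + B′ = B`, and both minima are their first argument. This
-- brings the exponent on the side of ρ, where the label of μ is `C + B`, to the form found on the
-- side of λ.
min-shiftʳ : ∀ {A′ B B′ C C′ j} → C ≡ 0 ⊎ C′ ≡ 0 → A′ N.+ B′ ≡ C′ N.+ B → j ≤ B′ →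
  (A′ N.+ j) ⊓ (C N.+ B) ≡ (A′ N.+ j) ⊓ B
min-shiftʳ (inj₁ ≡.refl) _ _ = ≡.refl
min-shiftʳ {A′} {B} {C = C} {j = j} (inj₂ ≡.refl) eq j≤B′ =
  ≡.trans (NP.m≤n⇒m⊓n≡m (NP.≤-trans A′+j≤B (NP.m≤n+m B C))) (≡.sym (NP.m≤n⇒m⊓n≡m A′+j≤B))
  where
  A′+j≤B : A′ N.+ j ≤ B
  A′+j≤B = ≡.subst (A′ N.+ j ≤_) eq (NP.+-monoʳ-≤ A′ j≤B′)

<ᵇ-true : ∀ c i → (c <ᵇ c N.+ suc i) ≡ true
<ᵇ-true zero    i = ≡.refl
<ᵇ-true (suc c) i = <ᵇ-true c i

<ᵇ-false : ∀ {b c} → b < c → (c <ᵇ b) ≡ false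
<ᵇ-false {zero}  (s≤s _)   = ≡.refl
<ᵇ-false {suc b} (s≤s b<c) = <ᵇ-false b<c

-- Vertex weights and the telescoping sum.

module VertexWeights {c ℓ} (R : CommutativeRing c ℓ) where
  open Lattice R
  open FiniteSums R
  open SetoidReasoning setoid
  open CommutativeMonoidSolver *-commutativeMonoid using (solve; _⊕_; _⊜_)

  pow-+ : ∀ u m n → pow u (m N.+ n) ≈ pow u m * pow u n
  pow-+ u zero    n = sym (*-identityˡ _)
  pow-+ u (suc m) n = trans (*-congˡ (pow-+ u m n)) (sym (*-assoc _ _ _))

  pow-* : ∀ u w n → pow (u * w) n ≈ pow u n * pow w n
  pow-* u w zero    = sym (*-identityˡ 1#)
  pow-* u w (suc n) = trans (*-congˡ (pow-* u w n))
    (solve 4 (λ p q r s → (p ⊕ q) ⊕ (r ⊕ s) ⊜ (p ⊕ r) ⊕ (q ⊕ s)) refl u w (pow u n) (pow w n))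

  pow-cong : ∀ n {u v} → u ≈ v → pow u n ≈ pow v n
  pow-cong zero    eq = refl
  pow-cong (suc n) eq = *-cong eq (pow-cong n eq)

  -- The second factor of `U` as a function of bottom minus right label; in a sum over an interval,
  -- 0 occurs exactly at its upper end.
  θ : Carrier → ℕ → Carrier
  θ u zero    = 1#
  θ u (suc _) = 1# - u

  U-≥ : ∀ u a i c d → U u a (c N.+ i) c d ≈ pow u a * θ u i
  U-≥ u a zero    c d rewrite ≡ᵇ-true (NP.+-identityʳ c) = sym (*-identityʳ _)
  U-≥ u a (suc i) c d rewrite ≡ᵇ-false (NP.>⇒≢ (NP.m<m+n c {suc i} (s≤s z≤n))) | <ᵇ-true c i = refl

  U-< : ∀ u a {b c} d → b < c → U u a b c d ≈ 0#
  U-< u a {b} {c} d b<c rewrite ≡ᵇ-false (NP.<⇒≢ b<c) | <ᵇ-false b<c = refl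

  -- A telescoping sum: when f is eventually constant it does not depend on its length.
  Φ : Carrier → ℕ → (ℕ → Carrier) → Carrier
  Φ u B f = ∑ (range B) λ j → θ u (B ∸ j) * (pow u j * f j)

  Φ-zero : ∀ u f → Φ u 0 f ≈ f 0
  Φ-zero u f = begin
    ∑ (range 0) (λ j → θ u (0 ∸ j) * (pow u j * f j)) ≈⟨ ∑-∷ 0 [] _ ⟩
    1# * (1# * f 0) + ∑ [] _                          ≈⟨ +-cong (trans (*-identityˡ _) (*-identityˡ _)) (∑-[] _) ⟩
    f 0 + 0#                                          ≈⟨ +-identityʳ _ ⟩
    f 0                                               ∎

  -- The coefficients depend on the distance to the upper end, so dropping the lowest term leaves a
  -- sum of the same kind; dropping the highest would not.
  Φ-suc : ∀ u B f → Φ u (suc B) f ≈ (1# - u) * f 0 + u * Φ u B (f ∘ suc)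
  Φ-suc u B f = begin
    Φ u (suc B) f
      ≈⟨ ∑-range-suc B _ ⟩
    (1# - u) * (1# * f 0) + ∑ (range B) (λ j → θ u (B ∸ j) * ((u * pow u j) * f (suc j)))
      ≈⟨ +-cong (*-congˡ (*-identityˡ _)) (∑-cong (range B) λ j →
           solve 4 (λ t v q g → t ⊕ ((v ⊕ q) ⊕ g) ⊜ v ⊕ (t ⊕ (q ⊕ g))) refl (θ u (B ∸ j)) u (pow u j) (f (suc j))) ⟩
    (1# - u) * f 0 + ∑ (range B) (λ j → u * (θ u (B ∸ j) * (pow u j * f (suc j))))
      ≈⟨ +-congˡ (sym (*-∑ u (range B) _)) ⟩
    (1# - u) * f 0 + u * Φ u B (f ∘ suc) ∎

  Φ-constant : ∀ u B f → (∀ j → f (suc j) ≈ f j) → Φ u B f ≈ f 0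
  Φ-constant u zero    f h = Φ-zero u f
  Φ-constant u (suc B) f h = begin
    Φ u (suc B) f                        ≈⟨ Φ-suc u B f ⟩
    (1# - u) * f 0 + u * Φ u B (f ∘ suc) ≈⟨ +-congˡ (*-congˡ (trans (Φ-constant u B (f ∘ suc) (h ∘ suc)) (h 0))) ⟩
    (1# - u) * f 0 + u * f 0             ≈⟨ sym (distribʳ (f 0) (1# - u) u) ⟩
    ((1# - u) + u) * f 0                 ≈⟨ *-congʳ (trans (+-assoc _ _ _) (trans (+-congˡ (-‿inverseˡ u)) (+-identityʳ 1#))) ⟩
    1# * f 0                             ≈⟨ *-identityˡ _ ⟩
    f 0                                  ∎

  Φ-stable : ∀ u n i f → (∀ j → n ≤ j → f (suc j) ≈ f j) → Φ u (n N.+ i) f ≈ Φ u n f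
  Φ-stable u zero    i f h = trans (Φ-constant u i f λ j → h j z≤n) (sym (Φ-zero u f))
  Φ-stable u (suc n) i f h = begin
    Φ u (suc n N.+ i) f                          ≈⟨ Φ-suc u (n N.+ i) f ⟩
    (1# - u) * f 0 + u * Φ u (n N.+ i) (f ∘ suc) ≈⟨ +-congˡ (*-congˡ (Φ-stable u n i (f ∘ suc) λ j n≤j → h (suc j) (s≤s n≤j))) ⟩
    (1# - u) * f 0 + u * Φ u n (f ∘ suc)         ≈⟨ sym (Φ-suc u n f) ⟩
    Φ u (suc n) f                                ∎

  -- The exponent is constant from `j = B ∸ A′` on, and both lengths reach this point: `B`
  -- trivially, `B′` because `A′ + B′ = C′ + B ≥ B`. Both sums therefore equal the one of length
  -- `B ∸ A′`.
  Φ-exchange : ∀ u w {A′ B B′ C′} → A′ N.+ B′ ≡ C′ N.+ B →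
    Φ u B (λ j → pow w ((A′ N.+ j) ⊓ B)) ≈ Φ u B′ (λ j → pow w ((A′ N.+ j) ⊓ B))
  Φ-exchange u w {A′} {B} {B′} {C′} eq = trans (toStable B (NP.m∸n≤m B A′)) (sym (toStable B′ (NP.m≤n+o⇒m∸n≤o B A′ B≤A′+B′)))
    where
    f : ℕ → Carrier
    f j = pow w ((A′ N.+ j) ⊓ B)
    B≤A′+B′ : B ≤ A′ N.+ B′
    B≤A′+B′ = ≡.subst (B ≤_) (≡.sym eq) (NP.m≤n+m B C′)
    saturated : ∀ {j} → B ∸ A′ ≤ j → (A′ N.+ j) ⊓ B ≡ B
    saturated n≤j = NP.m≥n⇒m⊓n≡n (NP.≤-trans (NP.m≤n+m∸n B A′) (NP.+-monoʳ-≤ A′ n≤j))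
    toStable : ∀ N → B ∸ A′ ≤ N → Φ u N f ≈ Φ u (B ∸ A′) f
    toStable N n≤N = trans (reflexive (≡.cong (λ t → Φ u t f) (≡.sym (NP.m+[n∸m]≡n n≤N))))
      (Φ-stable u (B ∸ A′) (N ∸ (B ∸ A′)) f λ j n≤j →
        reflexive (≡.cong (pow w) (≡.trans (saturated (NP.m≤n⇒m≤1+n n≤j)) (≡.sym (saturated n≤j)))))

-- Order in the variables `x`.

m⊓n+m∸n≡m : ∀ m n → (m ⊓ n) N.+ (m ∸ n) ≡ m
m⊓n+m∸n≡m m n = ≡.trans (≡.cong (N._+ (m ∸ n)) (NP.⊓-comm m n)) (NP.m⊓n+n∸m≡n n m)

module Monomials {c ℓ} (R : CommutativeRing c ℓ) where
  open Lattice R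
  open VertexWeights R
  open SetoidReasoning setoid
  open CommutativeMonoidSolver *-commutativeMonoid using (solve; _⊕_; _⊜_)

  -- Nilpotency is assumed in degree exactly D + 1; this divisor carries it to all higher degrees.
  -- The degree `n` is taken greedily from the first variables.
  monomial-truncate : ∀ {m} (x : Vec Carrier m) α n → n ≤ sum α →
    ∃ λ β → sum β ≡ n × ∃ λ q → monomial x α ≈ monomial x β * q
  monomial-truncate []      []      zero z≤n = [] , ≡.refl , 1# , sym (*-identityʳ 1#)
  monomial-truncate (v ∷ x) (a ∷ α) n    n≤
    with monomial-truncate x α (n ∸ a) (NP.m≤n+o⇒m∸n≤o n a n≤)
  ... | β , Σβ , q , eq =
    (n ⊓ a) ∷ β , ≡.trans (≡.cong ((n ⊓ a) N.+_) Σβ) (m⊓n+m∸n≡m n a) , pow v (a ∸ n) * q , (begin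
      pow v a * monomial x α
        ≈⟨ *-cong (trans (reflexive (≡.cong (pow v) (≡.sym (NP.m⊓n+n∸m≡n n a)))) (pow-+ v (n ⊓ a) (a ∸ n))) eq ⟩
      (pow v (n ⊓ a) * pow v (a ∸ n)) * (monomial x β * q)
        ≈⟨ solve 4 (λ p q r s → (p ⊕ q) ⊕ (r ⊕ s) ⊜ (p ⊕ r) ⊕ (q ⊕ s)) refl _ _ _ _ ⟩
      (pow v (n ⊓ a) * monomial x β) * (pow v (a ∸ n) * q) ∎)

  monomial-raise : ∀ {m} (x : Vec Carrier m) →
    ListAll.All (λ v → ∀ α → ∃ λ β → sum β ≡ suc (sum α) × monomial x β ≈ v * monomial x α) (toList x)
  monomial-raise []      = []
  monomial-raise (v ∷ x) =
    (λ { (a ∷ α) → suc a ∷ α , ≡.refl , *-assoc _ _ _ }) ∷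
    ListAll.map (λ raise → λ { (a ∷ α) → let β , Σβ , eq = raise α in
      a ∷ β , ≡.trans (≡.cong (a N.+_) Σβ) (NP.+-suc a (sum α)) ,
      trans (*-congˡ eq) (solve 3 (λ p q r → p ⊕ (q ⊕ r) ⊜ q ⊕ (p ⊕ r)) refl _ _ _) }) (monomial-raise x)

module Order {c ℓ} (R : CommutativeRing c ℓ) (D : ℕ) {m} (x : Vec (CommutativeRing.Carrier R) m) where
  open Lattice R
  open FiniteSums R
  open Monomials R
  open SetoidReasoning setoid
  open CommutativeMonoidSolver *-commutativeMonoid using (solve; _⊕_; _⊜_)

  -- A substitute for "every monomial of r has degree at least e in x", which makes sense in any
  -- ring in which the monomials of degree D + 1 vanish.
  Ord : ℕ → Carrier → Set ℓ
  Ord e r = ∀ (α : Vec ℕ m) → suc D ≤ sum α N.+ e → monomial x α * r ≈ 0#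

  -- `Ord 1 u` would be too weak, as `Ord` is not multiplicative: for `x` zero and D = 1 the unit
  -- satisfies `Ord 1`, but its square satisfies `Ord 2` only in the trivial ring.
  Positive : Carrier → Set _
  Positive u = ∀ {e r} → Ord e r → Ord (suc e) (r * u)

  Ord-resp : ∀ {e r r′} → r ≈ r′ → Ord e r → Ord e r′
  Ord-resp eq h α le = trans (*-congˡ (sym eq)) (h α le)

  Ord-* : ∀ {e r} k → Ord e r → Ord e (r * k)
  Ord-* k h α le = trans (sym (*-assoc _ _ k)) (trans (*-congʳ (h α le)) (zeroˡ k))

  Ord-0 : ∀ {e r} → r ≈ 0# → Ord e r
  Ord-0 eq α le = trans (*-congˡ eq) (zeroʳ _)

  Ord-mono : ∀ {e e′ r} → e′ ≤ e → Ord e r → Ord e′ r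
  Ord-mono e′≤e h α le = h α (NP.≤-trans le (NP.+-monoʳ-≤ (sum α) e′≤e))

  Ord-∑ : ∀ {a} {A : Set a} {e} xs {f : A → Carrier} → (∀ x → Ord e (f x)) → Ord e (∑ xs f)
  Ord-∑ xs h α le = trans (*-∑ _ xs _) (∑-zero xs λ x → h x α le)

  Ord-pow : ∀ {u} → Positive u → ∀ n {e r} → Ord e r → Ord (n N.+ e) (r * pow u n)
  Ord-pow u+ zero    h = Ord-resp (sym (*-identityʳ _)) h
  Ord-pow {u} u+ (suc n) {e} {r} h = Ord-resp
    (solve 3 (λ r p u → (r ⊕ p) ⊕ u ⊜ r ⊕ (u ⊕ p)) refl r (pow u n) u) (u+ (Ord-pow u+ n h))

  Positive-* : ∀ {u} k → Positive u → Positive (u * k)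
  Positive-* k u+ h = Ord-resp (*-assoc _ _ k) (Ord-* k (u+ h))

  monomial-replicate-0 : ∀ {k} (x : Vec Carrier k) → monomial x (replicate k 0) ≈ 1#
  monomial-replicate-0 []      = refl
  monomial-replicate-0 (v ∷ x) = trans (*-identityˡ _) (monomial-replicate-0 x)

  Ord-top : ∀ {e r} → suc D ≤ e → Ord e r → r ≈ 0#
  Ord-top {e} {r} D<e h = begin
    r                              ≈⟨ sym (*-identityˡ r) ⟩
    1# * r                         ≈⟨ *-congʳ (sym (monomial-replicate-0 x)) ⟩
    monomial x (replicate m 0) * r ≈⟨ h (replicate m 0) (NP.≤-trans D<e (NP.m≤n+m e _)) ⟩
    0#                             ∎

  -- A variable multiplying `r` can be moved into the annihilating monomial, whose degree goes up by
  -- one.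
  x-positive : ListAll.All Positive (toList x)
  x-positive = ListAll.map positive (monomial-raise x)
    where
    positive : ∀ {v} → (∀ α → ∃ λ β → sum β ≡ suc (sum α) × monomial x β ≈ v * monomial x α) → Positive v
    positive {v} raise {e} {r} h α le with raise α
    ... | β , Σβ , eq = begin
      monomial x α * (r * v) ≈⟨ solve 3 (λ p r v → p ⊕ (r ⊕ v) ⊜ (v ⊕ p) ⊕ r) refl _ r v ⟩
      (v * monomial x α) * r ≈⟨ *-congʳ (sym eq) ⟩
      monomial x β * r       ≈⟨ h β (≡.subst (suc D ≤_) (≡.trans (NP.+-suc (sum α) e) (≡.cong (N._+ e) (≡.sym Σβ))) le) ⟩
      0#                     ∎

  module _ (nilpotent : ∀ (α : Vec ℕ m) → sum α ≡ suc D → monomial x α ≈ 0#) where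

    Ord-bottom : ∀ {r} → Ord 0 r
    Ord-bottom {r} α le with monomial-truncate x α (suc D) (≡.subst (suc D ≤_) (NP.+-identityʳ _) le)
    ... | β , Σβ , q , eq = trans (*-congʳ (trans eq (trans (*-congʳ (nilpotent β Σβ)) (zeroˡ q)))) (zeroˡ r)

-- The skew Cauchy identity at a single site.

m<n∸o⇒m+o<n : ∀ m n o → m < n ∸ o → m N.+ o < n
m<n∸o⇒m+o<n m n o m< = NP.≰⇒> λ n≤ → NP.<⇒≱ m< (NP.m≤n+o⇒m∸n≤o n o (≡.subst (n ≤_) (NP.+-comm m o) n≤))

-- In the skew Cauchy identity: M = μ_s, N = κ_s, M′ = μ_{s+1}, N′ = κ_{s+1}, so that b and k are the
-- labels of μ and κ at site s.
module Site (b k M′ N′ : ℕ) where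
  M = b N.+ M′
  N = k N.+ N′
  -- `A + M` and `C + M′` are the larger of the parts of μ and κ at s and at s + 1. With λ_{s+1} =
  -- max(M′, N′) + j and ρ_s = min(M, N) - j, interlacing bounds `j` by `B` = M - max(M′, N′) and by
  -- `B′` = min(M, N) - N′, respectively, once `C ≤ b`.
  A = N ∸ M
  A′ = M ∸ N
  C = N′ ∸ M′
  C′ = M′ ∸ N′
  B = b ∸ C
  B′ = k ∸ A

  module _ (C≤b : C ≤ b) where

    -- The assumption `C ≤ b` says κ_{s+1} ≤ μ_s, which is what an admissible λ_{s+1} or ρ_s
    -- requires.
    N′≤M : N′ ≤ M
    N′≤M = NP.≤-trans (NP.m≤n+m∸n N′ M′) (≡.subst (M′ N.+ C ≤_) (NP.+-comm M′ b) (NP.+-monoʳ-≤ M′ C≤b))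

    A≤k : A ≤ k
    A≤k = NP.m≤n+o⇒m∸n≤o N M (≡.subst (N ≤_) (NP.+-comm k M) (NP.+-monoʳ-≤ k N′≤M))

    C+B : C N.+ B ≡ b
    C+B = NP.m+[n∸m]≡n C≤b

    A+B′ : A N.+ B′ ≡ k
    A+B′ = NP.m+[n∸m]≡n A≤k

    -- Both sides are μ_s - κ_{s+1}.
    A′+B′ : A′ N.+ B′ ≡ C′ N.+ B
    A′+B′ = NP.+-cancelʳ-≡ (A N.+ N′) (A′ N.+ B′) (C′ N.+ B) (begin
      A′ N.+ B′ N.+ (A N.+ N′) ≡⟨ lem₁ A′ B′ A N′ ⟩
      A′ N.+ (A N.+ B′ N.+ N′) ≡⟨ ≡.cong (λ t → A′ N.+ (t N.+ N′)) A+B′ ⟩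
      A′ N.+ N                 ≡⟨ ∸-balance M N ⟩
      A N.+ M                  ≡⟨ ≡.cong (λ t → A N.+ (t N.+ M′)) (≡.sym C+B) ⟩
      A N.+ (C N.+ B N.+ M′)   ≡⟨ lem₂ A C B M′ ⟩
      A N.+ B N.+ (C N.+ M′)   ≡⟨ ≡.cong (A N.+ B N.+_) (≡.sym (∸-balance M′ N′)) ⟩
      A N.+ B N.+ (C′ N.+ N′)  ≡⟨ lem₃ A B C′ N′ ⟩
      C′ N.+ B N.+ (A N.+ N′)  ∎)
      where
      open ≡.≡-Reasoning
      lem₁ : ∀ a b c d → a N.+ b N.+ (c N.+ d) ≡ a N.+ (c N.+ b N.+ d)
      lem₁ = solve-∀
      lem₂ : ∀ a b c d → a N.+ (b N.+ c N.+ d) ≡ a N.+ c N.+ (b N.+ d)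
      lem₂ = solve-∀
      lem₃ : ∀ a b c d → a N.+ b N.+ (c N.+ d) ≡ c N.+ b N.+ (a N.+ d)
      lem₃ = solve-∀

module TwoRows {c ℓ} (R : CommutativeRing c ℓ) (K : ℕ)
  (u w : ℕ → CommutativeRing.Carrier R) where
  open Lattice R
  open FiniteSums R
  open Transfer R K
  open VertexWeights R
  open SetoidReasoning setoid
  open CommutativeMonoidSolver *-commutativeMonoid using (solve; _⊕_; _⊜_)

  G g : RowWeight
  G s = U (u s)
  g s a b c d = pow (w s) (a ⊓ d)

  ∑-swap₃ : ∀ {a b c} {A : Set a} {B : Set b} {C : Set c} xs ys zs (f : A → B → C → Carrier) →
    ∑ xs (λ x → ∑ ys λ y → ∑ zs λ z → f x y z) ≈ ∑ zs (λ z → ∑ xs λ x → ∑ ys λ y → f x y z)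
  ∑-swap₃ xs ys zs f = trans (∑-cong xs λ x → ∑-swap ys zs (f x)) (∑-swap xs zs _)

  ∑-product : ∀ {a} {A : Set a} (ts : List A) (ρ σ : ℕ → A → Carrier) →
    ∑ ts (λ t → ∑ (range K) (λ c → ρ c t) * ∑ (range K) (λ c → σ c t))
    ≈ ∑ (range K) (λ c → ∑ (range K) λ c′ → ∑ ts λ t → ρ c t * σ c′ t)
  ∑-product ts ρ σ = begin
    ∑ ts (λ t → ∑ (range K) (λ c → ρ c t) * ∑ (range K) (λ c → σ c t))
      ≈⟨ ∑-cong ts (λ t → ∑-*-∑ (range K) (range K) _ _) ⟩
    ∑ ts (λ t → ∑ (range K) λ c → ∑ (range K) λ c′ → ρ c t * σ c′ t)
      ≈⟨ sym (∑-swap₃ (range K) (range K) ts λ c c′ t → ρ c t * σ c′ t) ⟩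
    ∑ (range K) (λ c → ∑ (range K) λ c′ → ∑ ts λ t → ρ c t * σ c′ t) ∎

  -- Once the right labels of the two vertices at a site are fixed, the shared vertical label there
  -- and those of the later sites are summed independently.
  ∑-column : ∀ S (α β : ℕ → ℕ → Carrier) (ρ σ : ℕ → Vec ℕ S → Carrier) →
    ∑ (range K) (λ d → ∑ (states S) λ t → ∑ (range K) (λ c → α c d * ρ c t) * ∑ (range K) (λ c → β c d * σ c t))
    ≈ ∑ (range K) (λ c → ∑ (range K) λ c′ → ∑ (range K) (λ d → α c d * β c′ d) * ∑ (states S) (λ t → ρ c t * σ c′ t))
  ∑-column S α β ρ σ = begin
    ∑ (range K) (λ d → ∑ (states S) λ t → ∑ (range K) (λ c → α c d * ρ c t) * ∑ (range K) (λ c → β c d * σ c t))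
      ≈⟨ ∑-cong (range K) (λ d → ∑-product (states S) (λ c t → α c d * ρ c t) (λ c t → β c d * σ c t)) ⟩
    ∑ (range K) (λ d → ∑ (range K) λ c → ∑ (range K) λ c′ → ∑ (states S) λ t → (α c d * ρ c t) * (β c′ d * σ c′ t))
      ≈⟨ sym (∑-swap₃ (range K) (range K) (range K) _) ⟩
    ∑ (range K) (λ c → ∑ (range K) λ c′ → ∑ (range K) λ d → ∑ (states S) λ t → (α c d * ρ c t) * (β c′ d * σ c′ t))
      ≈⟨ ∑-cong (range K) (λ c → ∑-cong (range K) λ c′ → trans
           (∑-cong (range K) λ d → ∑-cong (states S) λ t →
             solve 4 (λ p q r s → (p ⊕ q) ⊕ (r ⊕ s) ⊜ (p ⊕ r) ⊕ (q ⊕ s)) refl (α c d) (ρ c t) (β c′ d) (σ c′ t))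
           (sym (∑-*-∑ (range K) (states S) (λ d → α c d * β c′ d) (λ t → ρ c t * σ c′ t)))) ⟩
    ∑ (range K) (λ c → ∑ (range K) λ c′ → ∑ (range K) (λ d → α c d * β c′ d) * ∑ (states S) (λ t → ρ c t * σ c′ t)) ∎

  -- The sums over λ (meet) and over ρ (part, parts) of the skew Cauchy identity, from site s onwards
  -- and with given left labels of the two rows; bs are the labels of μ and ks those of κ.
  meet : ∀ {S} → ℕ → ℕ → ℕ → Vec ℕ S → Vec ℕ S → Carrier
  meet {S} s a a′ bs ks = ∑ (states S) λ t → row G s a bs t * row g s a′ ks t

  part : ∀ {S} → ℕ → ℕ → ℕ → Vec ℕ S → Vec ℕ S → Carrier
  part {S} s q p bs ks = ∑ (states S) λ t → row G s q t ks * row g s p t bs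

  parts : ∀ {S} → ℕ → Vec ℕ S → Vec ℕ S → Carrier
  parts s bs ks = ∑ (range K) λ q → ∑ (range K) λ p → part s q p bs ks

  meetVertex : ℕ → (a a′ b k c c′ : ℕ) → Carrier
  meetVertex s a a′ b k c c′ = ∑ (range K) λ d → vtx (G s) a b c d * vtx (g s) a′ k c′ d

  partVertex : ℕ → (q p b k q′ p′ : ℕ) → Carrier
  partVertex s q p b k q′ p′ = ∑ (range K) λ e → vtx (G s) q e q′ k * vtx (g s) p e p′ b

  meet-∷ : ∀ {S} s a a′ b k (bs ks : Vec ℕ S) → meet s a a′ (b ∷ bs) (k ∷ ks)
    ≈ ∑ (range K) (λ c → ∑ (range K) λ c′ → meetVertex s a a′ b k c c′ * meet (suc s) c c′ bs ks)
  meet-∷ {S} s a a′ b k bs ks = trans (∑-states-suc S _)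
    (∑-column S (λ c d → vtx (G s) a b c d) (λ c d → vtx (g s) a′ k c d)
       (λ c t → row G (suc s) c bs t) (λ c t → row g (suc s) c ks t))

  part-∷ : ∀ {S} s q p b k (bs ks : Vec ℕ S) → part s q p (b ∷ bs) (k ∷ ks)
    ≈ ∑ (range K) (λ q′ → ∑ (range K) λ p′ → partVertex s q p b k q′ p′ * part (suc s) q′ p′ bs ks)
  part-∷ {S} s q p b k bs ks = trans (∑-states-suc S _)
    (∑-column S (λ c e → vtx (G s) q e c k) (λ c e → vtx (g s) p e c b)
       (λ c t → row G (suc s) c t ks) (λ c t → row g (suc s) c t bs))

  *-0ˡ : ∀ {a b} → a ≈ 0# → a * b ≈ 0#
  *-0ˡ eq = trans (*-congʳ eq) (zeroˡ _)

  *-0ʳ : ∀ {a b} → b ≈ 0# → a * b ≈ 0#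
  *-0ʳ eq = trans (*-congˡ eq) (zeroʳ _)

  -- Both sums are the part λ_s of the common top row, so either left label determines the other.
  meet-≢ : ∀ {S} s a a′ (bs ks : Vec ℕ S) → a′ N.+ sum ks ≢ a N.+ sum bs → meet s a a′ bs ks ≈ 0#
  meet-≢ {S} s a a′ bs ks neq = ∑-zero (states S) term
    where
    term : ∀ t → row G s a bs t * row g s a′ ks t ≈ 0#
    term t with (a N.+ sum bs) N.≟ sum t
    ... | no  neq′ = *-0ˡ (row-≢ G s a bs t neq′)
    ... | yes eq   = *-0ʳ (row-≢ g s a′ ks t λ eq′ → neq (≡.trans eq′ (≡.sym eq)))

  -- Here ρ_s = κ_s - q = μ_s - p. The bound on `p` later keeps the labels of ρ in the summation
  -- range.
  part-≢ : ∀ {S} s q p (bs ks : Vec ℕ S) → ¬ (p N.+ sum ks ≡ q N.+ sum bs × p ≤ sum bs) → part s q p bs ks ≈ 0#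
  part-≢ {S} s q p bs ks neq = ∑-zero (states S) term
    where
    swap : ∀ p q m → p N.+ (q N.+ m) ≡ q N.+ (p N.+ m)
    swap = solve-∀
    term : ∀ t → row G s q t ks * row g s p t bs ≈ 0#
    term t with (q N.+ sum t) N.≟ sum ks | (p N.+ sum t) N.≟ sum bs
    ... | no  neq′ | _        = *-0ˡ (row-≢ G s q t ks neq′)
    ... | yes _    | no  neq′ = *-0ʳ (row-≢ g s p t bs neq′)
    ... | yes eq   | yes eq′  = ⊥-elim (neq
      ( ≡.trans (≡.cong (p N.+_) (≡.sym eq)) (≡.trans (swap p q (sum t)) (≡.cong (q N.+_) eq′))
      , ≡.subst (p ≤_) eq′ (NP.m≤m+n p (sum t))))

  vtx-G-< : ∀ s a b c d → b < c → vtx (G s) a b c d ≈ 0#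
  vtx-G-< s a b c d b<c with (a N.+ b) N.≟ (c N.+ d)
  ... | no  neq = vtx-≢ (G s) a b c d neq
  ... | yes eq  = trans (vtx-≡ (G s) a b c d eq) (U-< (u s) a d b<c)

  meetVertex-< : ∀ s a a′ b k c c′ → b < c → meetVertex s a a′ b k c c′ ≈ 0#
  meetVertex-< s a a′ b k c c′ b<c = ∑-zero (range K) λ d → *-0ˡ (vtx-G-< s a b c d b<c)

  -- A nonzero G weight needs `q′ ≤ e`, and conservation then gives `q ≤ k`, that is, κ_{s+1} ≤ ρ_s.
  partVertex-< : ∀ s q p b k q′ p′ → k < q → partVertex s q p b k q′ p′ ≈ 0#
  partVertex-< s q p b k q′ p′ k<q = ∑-zero (range K) λ e → *-0ˡ (term e)
    where
    term : ∀ e → vtx (G s) q e q′ k ≈ 0#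
    term e with e N.<? q′
    ... | yes e<q′ = vtx-G-< s q e q′ k e<q′
    ... | no  e≮q′ = vtx-≢ (G s) q e q′ k λ eq → NP.<⇒≢ (NP.+-mono-<-≤ k<q (NP.≮⇒≥ e≮q′)) (≡.trans (NP.+-comm k q′) (≡.sym eq))

  module SiteWeights (s b k M′ N′ : ℕ) (M≤K : b N.+ M′ ≤ K) (C≤b : Site.C b k M′ N′ ≤ b) where
    open Site b k M′ N′

    -- The g weight at ρ_s = min(μ_s, κ_s) - j, and also what is left of the g weight at λ_{s+1} =
    -- max(μ_{s+1}, κ_{s+1}) + j after powers are split off.
    profile : ℕ → Carrier
    profile j = pow (w s) ((A′ N.+ j) ⊓ B)

    -- The factor `pow p j` is what the sites to the right contribute. Its powers of `w s` complete
    -- the exponent, so that λ_s survives only in `pow p i`.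
    meetVertex-value : ∀ {p} → u s * w s ≈ p → ∀ i j → A N.+ i N.+ M ≤ K → j ≤ B →
      meetVertex s (A N.+ i) (A′ N.+ i) b k (C N.+ j) (C′ N.+ j) * pow p j
      ≈ (pow p i * pow (u s) A) * (θ (u s) (B ∸ j) * (pow (u s) j * profile j))
    meetVertex-value {p} uw i j a+M≤K j≤B = begin
      meetVertex s (A N.+ i) (A′ N.+ i) b k (C N.+ j) (C′ N.+ j) * pow p j
        ≈⟨ *-congʳ (∑-range-single d _ d≤K λ d′ d′≢d → *-0ˡ (vtx-≢ (G s) (A N.+ i) b (C N.+ j) d′ λ eq′ →
             d′≢d (NP.+-cancelˡ-≡ (C N.+ j) d′ d (≡.trans (≡.sym eq′) eqG)))) ⟩
      vtx (G s) (A N.+ i) b (C N.+ j) d * vtx (g s) (A′ N.+ i) k (C′ N.+ j) d * pow p j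
        ≈⟨ *-cong (*-cong (trans (vtx-≡ (G s) (A N.+ i) b (C N.+ j) d eqG) Uvalue) (vtx-≡ (g s) (A′ N.+ i) k (C′ N.+ j) d eqg)) powp ⟩
      (pow (u s) (A N.+ i) * θ (u s) o * pow (w s) ((A′ N.+ i) ⊓ d)) * (pow (u s) j * pow (w s) j)
        ≈⟨ solve 5 (λ a t m x y → ((a ⊕ t) ⊕ m) ⊕ (x ⊕ y) ⊜ a ⊕ (t ⊕ (x ⊕ (m ⊕ y)))) refl _ _ _ _ _ ⟩
      pow (u s) (A N.+ i) * (θ (u s) o * (pow (u s) j * (pow (w s) ((A′ N.+ i) ⊓ d) * pow (w s) j)))
        ≈⟨ *-cong (pow-+ (u s) A i) (*-congˡ (*-congˡ (trans (sym (pow-+ (w s) ((A′ N.+ i) ⊓ d) j))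
             (trans (reflexive (≡.cong (pow (w s)) exponent)) (pow-+ (w s) i _))))) ⟩
      (pow (u s) A * pow (u s) i) * (θ (u s) o * (pow (u s) j * (pow (w s) i * profile j)))
        ≈⟨ solve 6 (λ a b t x y f → (a ⊕ b) ⊕ (t ⊕ (x ⊕ (y ⊕ f))) ⊜ ((b ⊕ y) ⊕ a) ⊕ (t ⊕ (x ⊕ f))) refl _ _ _ _ _ _ ⟩
      ((pow (u s) i * pow (w s) i) * pow (u s) A) * (θ (u s) o * (pow (u s) j * profile j))
        ≈⟨ *-congʳ (*-congʳ (trans (sym (pow-* (u s) (w s) i)) (pow-cong i uw))) ⟩
      (pow p i * pow (u s) A) * (θ (u s) o * (pow (u s) j * profile j)) ∎
      where
      o = B ∸ j
      d = A N.+ i N.+ o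
      j+o : j N.+ o ≡ B
      j+o = NP.m+[n∸m]≡n j≤B
      b≡ : C N.+ j N.+ o ≡ b
      b≡ = ≡.trans (NP.+-assoc C j o) (≡.trans (≡.cong (C N.+_) j+o) (C+B C≤b))
      d≤K : d ≤ K
      d≤K = NP.≤-trans (NP.+-monoʳ-≤ (A N.+ i) (NP.≤-trans (NP.m∸n≤m B j) (NP.≤-trans (NP.m∸n≤m b C) (NP.m≤m+n b M′)))) a+M≤K
      rearr₁ : ∀ a c o → a N.+ (c N.+ o) ≡ c N.+ (a N.+ o)
      rearr₁ = solve-∀
      eqG : A N.+ i N.+ b ≡ C N.+ j N.+ d
      eqG = ≡.trans (≡.cong (A N.+ i N.+_) (≡.sym b≡)) (rearr₁ (A N.+ i) (C N.+ j) o)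
      rearr₂ : ∀ a b c i → a N.+ i N.+ (b N.+ c) ≡ a N.+ c N.+ (b N.+ i)
      rearr₂ = solve-∀
      rearr₃ : ∀ c a i j o → c N.+ (j N.+ o) N.+ (a N.+ i) ≡ c N.+ j N.+ (a N.+ i N.+ o)
      rearr₃ = solve-∀
      eqg : A′ N.+ i N.+ k ≡ C′ N.+ j N.+ d
      eqg = ≡.trans (≡.cong (A′ N.+ i N.+_) (≡.sym (A+B′ C≤b))) (≡.trans (rearr₂ A′ A B′ i)
        (≡.trans (≡.cong (N._+ (A N.+ i)) (≡.trans (A′+B′ C≤b) (≡.cong (C′ N.+_) (≡.sym j+o)))) (rearr₃ C′ A i j o)))
      Uvalue : U (u s) (A N.+ i) b (C N.+ j) d ≈ pow (u s) (A N.+ i) * θ (u s) o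
      Uvalue = trans (reflexive (≡.cong (λ t → U (u s) (A N.+ i) t (C N.+ j) d) (≡.sym b≡))) (U-≥ (u s) (A N.+ i) o (C N.+ j) d)
      powp : pow p j ≈ pow (u s) j * pow (w s) j
      powp = trans (pow-cong j (sym uw)) (pow-* (u s) (w s) j)
      exponent : (A′ N.+ i) ⊓ d N.+ j ≡ i N.+ ((A′ N.+ j) ⊓ B)
      exponent = ≡.trans (min-shiftˡ (∸-disjoint M N) i j o) (≡.cong (λ t → i N.+ ((A′ N.+ j) ⊓ t)) j+o)

    module _ (q′ p′ : ℕ) (bal : p′ N.+ N′ ≡ q′ N.+ M′) (p′≤M′ : p′ ≤ M′) where

      partVertex-value : ∀ j → j ≤ B′ →
        partVertex s (A N.+ j) (A′ N.+ j) b k q′ p′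
        ≈ pow (u s) A * (θ (u s) (B′ ∸ j) * (pow (u s) j * profile j))
      partVertex-value j j≤B′ = begin
        partVertex s (A N.+ j) (A′ N.+ j) b k q′ p′
          ≈⟨ ∑-range-single e _ e≤K (λ e′ e′≢e → *-0ˡ (vtx-≢ (G s) (A N.+ j) e′ q′ k λ eq′ →
               e′≢e (NP.+-cancelˡ-≡ (A N.+ j) e′ e (≡.trans eq′ (≡.sym eqG))))) ⟩
        vtx (G s) (A N.+ j) e q′ k * vtx (g s) (A′ N.+ j) e p′ b
          ≈⟨ *-cong (trans (vtx-≡ (G s) (A N.+ j) e q′ k eqG) (trans (U-≥ (u s) (A N.+ j) o q′ k) (*-congʳ (pow-+ (u s) A j))))
                    (trans (vtx-≡ (g s) (A′ N.+ j) e p′ b eqg) (reflexive (≡.cong (pow (w s)) exponent))) ⟩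
        ((pow (u s) A * pow (u s) j) * θ (u s) o) * profile j
          ≈⟨ solve 4 (λ a b t f → ((a ⊕ b) ⊕ t) ⊕ f ⊜ a ⊕ (t ⊕ (b ⊕ f))) refl _ _ _ _ ⟩
        pow (u s) A * (θ (u s) o * (pow (u s) j * profile j)) ∎
        where
        o = B′ ∸ j
        e = q′ N.+ o
        j+o : j N.+ o ≡ B′
        j+o = NP.m+[n∸m]≡n j≤B′
        rearr₁ : ∀ a j q o → a N.+ j N.+ (q N.+ o) ≡ q N.+ (a N.+ (j N.+ o))
        rearr₁ = solve-∀
        eqG : A N.+ j N.+ e ≡ q′ N.+ k
        eqG = ≡.trans (rearr₁ A j q′ o) (≡.cong (q′ N.+_) (≡.trans (≡.cong (A N.+_) j+o) (A+B′ C≤b)))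
        rearr₂ : ∀ q c b n → q N.+ (c N.+ b) N.+ n ≡ q N.+ b N.+ (c N.+ n)
        rearr₂ = solve-∀
        rearr₃ : ∀ q b c m → q N.+ b N.+ (c N.+ m) ≡ q N.+ m N.+ (c N.+ b)
        rearr₃ = solve-∀
        rearr₄ : ∀ p n b → p N.+ n N.+ b ≡ p N.+ b N.+ n
        rearr₄ = solve-∀
        eqg : A′ N.+ j N.+ e ≡ p′ N.+ b
        eqg = ≡.trans (rearr₁ A′ j q′ o) (≡.trans (≡.cong (q′ N.+_) (≡.trans (≡.cong (A′ N.+_) j+o) (A′+B′ C≤b)))
          (NP.+-cancelʳ-≡ N′ _ _ (≡.trans (rearr₂ q′ C′ B N′) (≡.trans (≡.cong (q′ N.+ B N.+_) (∸-balance M′ N′))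
            (≡.trans (rearr₃ q′ B C M′) (≡.trans (≡.cong₂ N._+_ (≡.sym bal) (C+B C≤b)) (rearr₄ p′ N′ b)))))))
        e≤K : e ≤ K
        e≤K = NP.≤-trans (NP.m≤n+m e (A′ N.+ j)) (≡.subst (_≤ K) (≡.sym eqg)
          (NP.≤-trans (NP.+-monoˡ-≤ b p′≤M′) (≡.subst (_≤ K) (NP.+-comm b M′) M≤K)))
        exponent : (A′ N.+ j) ⊓ b ≡ (A′ N.+ j) ⊓ B
        exponent = ≡.trans (≡.cong ((A′ N.+ j) ⊓_) (≡.sym (C+B C≤b))) (min-shiftʳ (∸-disjoint M′ N′) (A′+B′ C≤b) j≤B′)

-- The skew Cauchy identity on D sites.

sum≤wsize : ∀ {S} s (v : Vec ℕ S) → sum v ≤ wsize (suc s) (toList v)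
sum≤wsize s []      = z≤n
sum≤wsize s (b ∷ v) = NP.+-mono-≤ (NP.m≤m+n b (s N.* b)) (sum≤wsize (suc s) v)

-- Along a row, the size of the partition grows by the sum of the horizontal labels.
wsize-step : ∀ s a b c d E e m n → a N.+ b ≡ c N.+ d →
  E N.+ (suc s N.* b N.+ m N.+ s N.* a) ≤ e N.+ (suc s N.* d N.+ n) →
  E N.+ (m N.+ suc s N.* c) ≤ a N.+ e N.+ n
wsize-step s a b c d E e m n eq le = NP.+-cancelʳ-≤ (suc s N.* d) _ _ (begin
  E N.+ (m N.+ suc s N.* c) N.+ suc s N.* d             ≡⟨ lem₁ s c d E m ⟩
  E N.+ (m N.+ suc s N.* (c N.+ d))                     ≡⟨ ≡.cong (λ t → E N.+ (m N.+ suc s N.* t)) (≡.sym eq) ⟩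
  E N.+ (m N.+ suc s N.* (a N.+ b))                     ≡⟨ lem₂ s a b E m ⟩
  a N.+ (E N.+ (suc s N.* b N.+ m N.+ s N.* a))         ≤⟨ NP.+-monoʳ-≤ a le ⟩
  a N.+ (e N.+ (suc s N.* d N.+ n))                     ≡⟨ lem₃ s a d e n ⟩
  a N.+ e N.+ n N.+ suc s N.* d                         ∎)
  where
  open NP.≤-Reasoning
  lem₁ : ∀ s c d E m → E N.+ (m N.+ suc s N.* c) N.+ suc s N.* d ≡ E N.+ (m N.+ suc s N.* (c N.+ d))
  lem₁ = solve-∀
  lem₂ : ∀ s a b E m → E N.+ (m N.+ suc s N.* (a N.+ b)) ≡ a N.+ (E N.+ (suc s N.* b N.+ m N.+ s N.* a))
  lem₂ = solve-∀
  lem₃ : ∀ s a d e n → a N.+ (e N.+ (suc s N.* d N.+ n)) ≡ a N.+ e N.+ n N.+ suc s N.* d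
  lem₃ = solve-∀

module SkewCauchy {c ℓ} (R : CommutativeRing c ℓ) (D : ℕ) {m} (x : Vec (CommutativeRing.Carrier R) m)
  (u w : ℕ → CommutativeRing.Carrier R) (p : CommutativeRing.Carrier R)
  (uw : ∀ s → CommutativeRing._≈_ R (CommutativeRing._*_ R (u s) (w s)) p) where
  open Lattice R
  open FiniteSums R
  open Transfer R D
  open VertexWeights R
  open TwoRows R D u w
  open Order R D x
  open SetoidReasoning setoid
  open CommutativeMonoidSolver *-commutativeMonoid using (solve; _⊕_; _⊜_)

  partVertex-≢ : ∀ s q r b k {q′ r′ M′ N′} → r′ N.+ N′ ≡ q′ N.+ M′ →
    r N.+ (k N.+ N′) ≢ q N.+ (b N.+ M′) → partVertex s q r b k q′ r′ ≈ 0#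
  partVertex-≢ s q r b k {q′} {r′} {M′} {N′} bal neq = ∑-zero (range D) term
    where
    rearr₁ : ∀ r k n e → r N.+ (k N.+ n) N.+ e ≡ r N.+ e N.+ (k N.+ n)
    rearr₁ = solve-∀
    rearr₂ : ∀ r b k n → r N.+ b N.+ (k N.+ n) ≡ r N.+ n N.+ (k N.+ b)
    rearr₂ = solve-∀
    rearr₃ : ∀ q m k b → q N.+ m N.+ (k N.+ b) ≡ q N.+ k N.+ (b N.+ m)
    rearr₃ = solve-∀
    rearr₄ : ∀ q e b m → q N.+ e N.+ (b N.+ m) ≡ q N.+ (b N.+ m) N.+ e
    rearr₄ = solve-∀
    term : ∀ e → vtx (G s) q e q′ k * vtx (g s) r e r′ b ≈ 0#
    term e with (q N.+ e) N.≟ (q′ N.+ k) | (r N.+ e) N.≟ (r′ N.+ b)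
    ... | no  neq′ | _        = *-0ˡ (vtx-≢ (G s) q e q′ k neq′)
    ... | yes _    | no  neq′ = *-0ʳ (vtx-≢ (g s) r e r′ b neq′)
    ... | yes eq   | yes eq′  = ⊥-elim (neq (NP.+-cancelʳ-≡ e _ _
      (≡.trans (rearr₁ r k N′ e) (≡.trans (≡.cong (N._+ (k N.+ N′)) eq′) (≡.trans (rearr₂ r′ b k N′)
        (≡.trans (≡.cong (N._+ (k N.+ b)) bal) (≡.trans (rearr₃ q′ M′ k b)
          (≡.trans (≡.cong (N._+ (b N.+ M′)) (≡.sym eq)) (rearr₄ q e b M′)))))))))

  -- The sum over ρ_s comes out as a factor when it is the same for every ρ_{s+1}. This is demanded
  -- only for right labels `q′`, `r′` that some ρ_{s+1} can produce, since `part` vanishes for the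
  -- others.
  parts-∷ : ∀ {S} s b k (bs ks : Vec ℕ S) f →
    (∀ q′ r′ → r′ N.+ sum ks ≡ q′ N.+ sum bs → r′ ≤ sum bs →
      ∑ (range D) (λ q → ∑ (range D) λ r → partVertex s q r b k q′ r′) ≈ f) →
    parts s (b ∷ bs) (k ∷ ks) ≈ f * parts (suc s) bs ks
  parts-∷ s b k bs ks f h = begin
    ∑ (range D) (λ q → ∑ (range D) λ r → part s q r (b ∷ bs) (k ∷ ks))
      ≈⟨ ∑-cong (range D) (λ q → ∑-cong (range D) λ r → part-∷ s q r b k bs ks) ⟩
    ∑ (range D) (λ q → ∑ (range D) λ r → ∑ (range D) λ q′ → ∑ (range D) λ r′ → V q r q′ r′ * part (suc s) q′ r′ bs ks)
      ≈⟨ ∑-swap₃ (range D) (range D) (range D) _ ⟩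
    ∑ (range D) (λ q′ → ∑ (range D) λ q → ∑ (range D) λ r → ∑ (range D) λ r′ → V q r q′ r′ * part (suc s) q′ r′ bs ks)
      ≈⟨ ∑-cong (range D) (λ q′ → ∑-swap₃ (range D) (range D) (range D) _) ⟩
    ∑ (range D) (λ q′ → ∑ (range D) λ r′ → ∑ (range D) λ q → ∑ (range D) λ r → V q r q′ r′ * part (suc s) q′ r′ bs ks)
      ≈⟨ ∑-cong (range D) (λ q′ → ∑-cong (range D) λ r′ → factor q′ r′) ⟩
    ∑ (range D) (λ q′ → ∑ (range D) λ r′ → f * part (suc s) q′ r′ bs ks)
      ≈⟨ ∑-cong (range D) (λ q′ → sym (*-∑ f (range D) _)) ⟩
    ∑ (range D) (λ q′ → f * ∑ (range D) λ r′ → part (suc s) q′ r′ bs ks)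
      ≈⟨ sym (*-∑ f (range D) _) ⟩
    f * parts (suc s) bs ks ∎
    where
    V : ℕ → ℕ → ℕ → ℕ → Carrier
    V q r q′ r′ = partVertex s q r b k q′ r′
    factor : ∀ q′ r′ → ∑ (range D) (λ q → ∑ (range D) λ r → V q r q′ r′ * part (suc s) q′ r′ bs ks)
      ≈ f * part (suc s) q′ r′ bs ks
    factor q′ r′ = trans (trans (∑-cong (range D) λ q → sym (∑-* _ (range D) _)) (sym (∑-* _ (range D) _))) cases
      where
      cases : ∑ (range D) (λ q → ∑ (range D) λ r → V q r q′ r′) * part (suc s) q′ r′ bs ks ≈ f * part (suc s) q′ r′ bs ks
      cases with (r′ N.+ sum ks) N.≟ (q′ N.+ sum bs) | r′ N.≤? sum bs
      ... | no  neq | _      = trans (*-0ʳ p≈0) (sym (*-0ʳ p≈0))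
        where p≈0 = part-≢ (suc s) q′ r′ bs ks λ (eq , _) → neq eq
      ... | yes _   | no  r≰ = trans (*-0ʳ p≈0) (sym (*-0ʳ p≈0))
        where p≈0 = part-≢ (suc s) q′ r′ bs ks λ (_ , le) → r≰ le
      ... | yes eq  | yes r≤ = *-congʳ (h q′ r′ eq r≤)

  parts-∷-0 : ∀ {S} s b k (bs ks : Vec ℕ S) → b < sum ks ∸ sum bs → parts s (b ∷ bs) (k ∷ ks) ≈ 0#
  parts-∷-0 s b k bs ks b<C = trans (parts-∷ s b k bs ks 0# λ q′ r′ bal _ →
      ∑-zero (range D) λ q → ∑-zero (range D) λ r → term q′ r′ q r bal) (zeroˡ _)
    where
    term : ∀ q′ r′ q r → r′ N.+ sum ks ≡ q′ N.+ sum bs → partVertex s q r b k q′ r′ ≈ 0#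
    term q′ r′ q r bal with q N.≤? k
    ... | no  q≰k = partVertex-< s q r b k q′ r′ (NP.≰⇒> q≰k)
    ... | yes q≤k = partVertex-≢ s q r b k bal (NP.>⇒≢ (NP.<-≤-trans
          (NP.+-mono-≤-< q≤k (m<n∸o⇒m+o<n b (sum ks) (sum bs) b<C)) (NP.m≤n+m _ r)))

  parts-∷-Φ : ∀ {S} s b k (bs ks : Vec ℕ S) (let open Site b k (sum bs) (sum ks)) →
    M ≤ D → k ≤ D → C ≤ b →
    parts s (b ∷ bs) (k ∷ ks) ≈ (pow (u s) A * Φ (u s) B′ (λ j → pow (w s) ((A′ N.+ j) ⊓ B))) * parts (suc s) bs ks
  parts-∷-Φ s b k bs ks M≤D k≤D C≤b = parts-∷ s b k bs ks _ λ q′ r′ bal r′≤ → begin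
    ∑ (range D) (λ q → ∑ (range D) λ r → partVertex s q r b k q′ r′)
      ≈⟨ ∑-window A B′ _ (≡.subst (_≤ D) (≡.sym (A+B′ C≤b)) k≤D) (λ q _ out → ∑-zero (range D) λ r → outside q′ r′ bal q r out) ⟩
    ∑ (range B′) (λ j → ∑ (range D) λ r → partVertex s (A N.+ j) r b k q′ r′)
      ≈⟨ ∑-cong-∈ (range B′) (λ j j∈ → trans (∑-range-single (A′ N.+ j) _ (A′+j≤D (∈-range⇒≤ j∈))
           λ r r≢ → partVertex-≢ s (A N.+ j) r b k bal λ eq → r≢ (NP.+-cancelʳ-≡ N r (A′ N.+ j) (≡.trans eq (≡.sym (shift j)))))
           (partVertex-value q′ r′ bal r′≤ j (∈-range⇒≤ j∈))) ⟩
    ∑ (range B′) (λ j → pow (u s) A * (θ (u s) (B′ ∸ j) * (pow (u s) j * profile j)))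
      ≈⟨ sym (*-∑ _ (range B′) _) ⟩
    pow (u s) A * Φ (u s) B′ profile ∎
    where
    open Site b k (sum bs) (sum ks)
    open SiteWeights s b k (sum bs) (sum ks) M≤D C≤b
    outside : ∀ q′ r′ → r′ N.+ sum ks ≡ q′ N.+ sum bs → ∀ q r → q < A ⊎ A N.+ B′ < q → partVertex s q r b k q′ r′ ≈ 0#
    outside q′ r′ bal q r (inj₁ q<A) = partVertex-≢ s q r b k bal
      (NP.>⇒≢ (NP.<-≤-trans (m<n∸o⇒m+o<n q N M q<A) (NP.m≤n+m N r)))
    outside q′ r′ bal q r (inj₂ k<q) = partVertex-< s q r b k q′ r′ (≡.subst (_< q) (A+B′ C≤b) k<q)
    A′+j≤D : ∀ {j} → j ≤ B′ → A′ N.+ j ≤ D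
    A′+j≤D j≤ = NP.≤-trans (NP.+-monoʳ-≤ A′ j≤) (≡.subst (_≤ D) (≡.sym (A′+B′ C≤b)) (NP.≤-trans
      (NP.+-mono-≤ (NP.m∸n≤m (sum bs) (sum ks)) (NP.m∸n≤m b C)) (≡.subst (_≤ D) (NP.+-comm b (sum bs)) M≤D)))
    rearr : ∀ a j n → a N.+ j N.+ n ≡ a N.+ n N.+ j
    rearr = solve-∀
    shift : ∀ j → A′ N.+ j N.+ N ≡ A N.+ j N.+ M
    shift j = ≡.trans (rearr A′ j N) (≡.trans (≡.cong (N._+ j) (∸-balance M N)) (rearr A M j))

  parts-[] : ∀ s → parts s [] [] ≈ 1#
  parts-[] s = begin
    ∑ (range D) (λ q → ∑ (range D) λ r → part s q r [] [])
      ≈⟨ ∑-range-single 0 _ z≤n (λ q q≢0 → ∑-zero (range D) λ r → part-≢ s q r [] [] λ (eq , r≤0) →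
           q≢0 (NP.m+n≡0⇒m≡0 q (≡.trans (≡.sym eq) (≡.trans (NP.+-identityʳ r) (NP.n≤0⇒n≡0 r≤0))))) ⟩
    ∑ (range D) (λ r → part s 0 r [] [])
      ≈⟨ ∑-range-single 0 _ z≤n (λ r r≢0 → part-≢ s 0 r [] [] λ (_ , r≤0) → r≢0 (NP.n≤0⇒n≡0 r≤0)) ⟩
    part s 0 0 [] []
      ≈⟨ trans (∑-singleton [] _) (*-identityˡ 1#) ⟩
    1# ∎

  -- Each extra unit of both left labels contributes a factor p = x y, whatever the rest of the rows.
  -- On the left-hand side no label leaves the last site D; r kills the terms missing for that reason.
  meet-closed : Positive p → ∀ {S} s (bs ks : Vec ℕ S) i {e r} → Ord e r →
    s N.+ S ≡ D → All (_≤ D) ks → wsize (suc s) (toList bs) ≤ e →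
    (1 ≤ (sum ks ∸ sum bs) N.+ i → s ≤ e) → (sum ks ∸ sum bs) N.+ i N.+ sum bs ≤ D →
    r * meet (suc s) ((sum ks ∸ sum bs) N.+ i) ((sum bs ∸ sum ks) N.+ i) bs ks
    ≈ r * (pow p i * parts (suc s) bs ks)
  meet-closed p+ s [] [] zero {r = r} ord _ _ _ _ _ = *-congˡ (begin
    meet (suc s) 0 0 [] []         ≈⟨ trans (∑-singleton [] _) (*-identityˡ 1#) ⟩
    1#                             ≈⟨ sym (parts-[] (suc s)) ⟩
    parts (suc s) [] []            ≈⟨ sym (*-identityˡ _) ⟩
    1# * parts (suc s) [] []       ∎)
  -- Here s = D, and the nonzero left label gives `D ≤ e`; one factor `p` raises the order of `r` to
  -- D + 1, so the right-hand side vanishes as well.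
  meet-closed p+ s [] [] (suc i) {e} {r} ord s+0≡D _ _ s≤e _ = trans
    (*-0ʳ (trans (∑-singleton [] _) (zeroˡ _)))
    (sym (Ord-top (s≤s (≡.subst (_≤ e) (≡.trans (≡.sym (NP.+-identityʳ s)) s+0≡D) (s≤e (s≤s z≤n))))
      (Ord-resp (solve 4 (λ r p q t → (r ⊕ p) ⊕ (q ⊕ t) ⊜ r ⊕ ((p ⊕ q) ⊕ t)) refl r p (pow p i) (parts (suc s) [] []))
        (Ord-* _ (p+ ord)))))
  meet-closed p+ {suc S} s (b ∷ bs) (k ∷ ks) i {e} {r} ord s+S≡D (k≤D ∷ ks≤D) size≤e _ a+M≤D
    with Site.C b k (sum bs) (sum ks) N.≤? b
  -- Now κ_{s+1} > μ_s, whereas both λ_{s+1} and ρ_s would have to lie between κ_{s+1} and μ_s: both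
  -- sides are empty.
  ... | no C≰b = begin
    r * meet (suc s) (A N.+ i) (A′ N.+ i) (b ∷ bs) (k ∷ ks)
      ≈⟨ *-0ʳ (trans (meet-∷ (suc s) (A N.+ i) (A′ N.+ i) b k bs ks) (∑-zero (range D) λ c → ∑-zero (range D) λ c′ → term c c′)) ⟩
    0#
      ≈⟨ sym (*-0ʳ (*-0ʳ (parts-∷-0 (suc s) b k bs ks (NP.≰⇒> C≰b)))) ⟩
    r * (pow p i * parts (suc s) (b ∷ bs) (k ∷ ks)) ∎
    where
    open Site b k (sum bs) (sum ks)
    term : ∀ c c′ → meetVertex (suc s) (A N.+ i) (A′ N.+ i) b k c c′ * meet (suc (suc s)) c c′ bs ks ≈ 0#
    term c c′ with c N.≤? b
    ... | no  c≰b = *-0ˡ (meetVertex-< (suc s) (A N.+ i) (A′ N.+ i) b k c c′ (NP.≰⇒> c≰b))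
    ... | yes c≤b = *-0ʳ (meet-≢ (suc (suc s)) c c′ bs ks (NP.>⇒≢ (NP.<-≤-trans
          (m<n∸o⇒m+o<n c (sum ks) (sum bs) (NP.≤-<-trans c≤b (NP.≰⇒> C≰b))) (NP.m≤n+m (sum ks) c′))))
  ... | yes C≤b = begin
    r * meet (suc s) (A N.+ i) (A′ N.+ i) (b ∷ bs) (k ∷ ks)
      ≈⟨ *-congˡ (meet-∷ (suc s) (A N.+ i) (A′ N.+ i) b k bs ks) ⟩
    r * ∑ (range D) (λ c → ∑ (range D) λ c′ → V c c′ * meet (suc (suc s)) c c′ bs ks)
      ≈⟨ *-congˡ (trans (∑-window C B _ C+B≤D λ c _ out → ∑-zero (range D) λ c′ → outside c c′ out)
           (∑-cong-∈ (range B) λ j j∈ → ∑-range-single (C′ N.+ j) _ (C′+j≤D (∈-range⇒≤ j∈)) λ c′ c′≢ →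
              *-0ʳ (meet-≢ (suc (suc s)) (C N.+ j) c′ bs ks λ eq → c′≢ (NP.+-cancelʳ-≡ (sum ks) c′ (C′ N.+ j) (≡.trans eq (≡.sym (shift j))))))) ⟩
    r * ∑ (range B) (λ j → V (C N.+ j) (C′ N.+ j) * meet (suc (suc s)) (C N.+ j) (C′ N.+ j) bs ks)
      ≈⟨ *-∑ r (range B) _ ⟩
    ∑ (range B) (λ j → r * (V (C N.+ j) (C′ N.+ j) * meet (suc (suc s)) (C N.+ j) (C′ N.+ j) bs ks))
      ≈⟨ ∑-cong-∈ (range B) (λ j j∈ → step j (∈-range⇒≤ j∈)) ⟩
    ∑ (range B) (λ j → (r * (pow p i * (pow (u (suc s)) A * T))) * (θ (u (suc s)) (B ∸ j) * (pow (u (suc s)) j * profile j)))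
      ≈⟨ sym (*-∑ _ (range B) _) ⟩
    (r * (pow p i * (pow (u (suc s)) A * T))) * Φ (u (suc s)) B profile
      -- The range of λ_{s+1} is exchanged for that of ρ_s; the summands already agree.
      ≈⟨ *-congˡ (Φ-exchange (u (suc s)) (w (suc s)) (A′+B′ C≤b)) ⟩
    (r * (pow p i * (pow (u (suc s)) A * T))) * Φ (u (suc s)) B′ profile
      ≈⟨ solve 5 (λ r q a t f → (r ⊕ (q ⊕ (a ⊕ t))) ⊕ f ⊜ r ⊕ (q ⊕ ((a ⊕ f) ⊕ t))) refl _ _ _ _ _ ⟩
    r * (pow p i * ((pow (u (suc s)) A * Φ (u (suc s)) B′ profile) * T))
      ≈⟨ *-congˡ (*-congˡ (sym (parts-∷-Φ (suc s) b k bs ks M≤D k≤D C≤b))) ⟩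
    r * (pow p i * parts (suc s) (b ∷ bs) (k ∷ ks)) ∎
    where
    open Site b k (sum bs) (sum ks)
    M≤D : M ≤ D
    M≤D = NP.m+n≤o⇒n≤o (A N.+ i) a+M≤D
    open SiteWeights (suc s) b k (sum bs) (sum ks) M≤D C≤b
    T = parts (suc (suc s)) bs ks
    V : ℕ → ℕ → Carrier
    V c c′ = meetVertex (suc s) (A N.+ i) (A′ N.+ i) b k c c′
    C+B≤D : C N.+ B ≤ D
    C+B≤D = ≡.subst (_≤ D) (≡.sym (C+B C≤b)) (NP.m+n≤o⇒m≤o b M≤D)
    C+j≤b : ∀ {j} → j ≤ B → C N.+ j ≤ b
    C+j≤b j≤ = ≡.subst (_ ≤_) (C+B C≤b) (NP.+-monoʳ-≤ C j≤)
    rearr : ∀ a j n → a N.+ j N.+ n ≡ a N.+ n N.+ j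
    rearr = solve-∀
    shift : ∀ j → C′ N.+ j N.+ sum ks ≡ C N.+ j N.+ sum bs
    shift j = ≡.trans (rearr C′ j (sum ks)) (≡.trans (≡.cong (N._+ j) (∸-balance (sum bs) (sum ks))) (rearr C (sum bs) j))
    C+j+M′≤D : ∀ {j} → j ≤ B → C N.+ j N.+ sum bs ≤ D
    C+j+M′≤D j≤ = NP.≤-trans (NP.+-monoˡ-≤ (sum bs) (C+j≤b j≤)) M≤D
    C′+j≤D : ∀ {j} → j ≤ B → C′ N.+ j ≤ D
    C′+j≤D {j} j≤ = NP.m+n≤o⇒m≤o (C′ N.+ j) (≡.subst (_≤ D) (≡.sym (shift j)) (C+j+M′≤D j≤))
    outside : ∀ c c′ → c < C ⊎ C N.+ B < c → V c c′ * meet (suc (suc s)) c c′ bs ks ≈ 0#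
    outside c c′ (inj₁ c<C) = *-0ʳ (meet-≢ (suc (suc s)) c c′ bs ks (NP.>⇒≢ (NP.<-≤-trans
          (m<n∸o⇒m+o<n c (sum ks) (sum bs) c<C) (NP.m≤n+m (sum ks) c′))))
    outside c c′ (inj₂ b<c) = *-0ˡ (meetVertex-< (suc s) (A N.+ i) (A′ N.+ i) b k c c′ (≡.subst (_< c) (C+B C≤b) b<c))
    -- A nonzero right label needs a bottom label `b` at least as large, which adds at least `suc s`
    -- to the size of μ.
    s≤e : ∀ {j} → j ≤ B → 1 ≤ C N.+ j → suc s ≤ e
    s≤e j≤ 1≤ = NP.≤-trans (NP.≤-trans (≡.subst (_≤ suc s N.* b) (NP.*-identityʳ (suc s))
      (NP.*-monoʳ-≤ (suc s) (NP.≤-trans 1≤ (C+j≤b j≤)))) (NP.m≤m+n _ _)) size≤e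
    step : ∀ j → j ≤ B → r * (V (C N.+ j) (C′ N.+ j) * meet (suc (suc s)) (C N.+ j) (C′ N.+ j) bs ks)
      ≈ (r * (pow p i * (pow (u (suc s)) A * T))) * (θ (u (suc s)) (B ∸ j) * (pow (u (suc s)) j * profile j))
    step j j≤ = begin
      r * (V (C N.+ j) (C′ N.+ j) * meet (suc (suc s)) (C N.+ j) (C′ N.+ j) bs ks)
        ≈⟨ solve 3 (λ r v m → r ⊕ (v ⊕ m) ⊜ v ⊕ (r ⊕ m)) refl _ _ _ ⟩
      V (C N.+ j) (C′ N.+ j) * (r * meet (suc (suc s)) (C N.+ j) (C′ N.+ j) bs ks)
        ≈⟨ *-congˡ (meet-closed p+ (suc s) bs ks j ord (≡.trans (≡.sym (NP.+-suc s S)) s+S≡D) ks≤D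
             (NP.≤-trans (NP.m≤n+m _ (suc s N.* b)) size≤e) (s≤e j≤) (C+j+M′≤D j≤)) ⟩
      V (C N.+ j) (C′ N.+ j) * (r * (pow p j * T))
        ≈⟨ solve 4 (λ v r q t → v ⊕ (r ⊕ (q ⊕ t)) ⊜ (v ⊕ q) ⊕ (r ⊕ t)) refl _ _ _ _ ⟩
      (V (C N.+ j) (C′ N.+ j) * pow p j) * (r * T)
        ≈⟨ *-congʳ (meetVertex-value (uw (suc s)) i j a+M≤D j≤) ⟩
      ((pow p i * pow (u (suc s)) A) * (θ (u (suc s)) (B ∸ j) * (pow (u (suc s)) j * profile j))) * (r * T)
        ≈⟨ solve 5 (λ q a f r t → ((q ⊕ a) ⊕ f) ⊕ (r ⊕ t) ⊜ (r ⊕ (q ⊕ (a ⊕ t))) ⊕ f) refl _ _ _ _ _ ⟩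
      (r * (pow p i * (pow (u (suc s)) A * T))) * (θ (u (suc s)) (B ∸ j) * (pow (u (suc s)) j * profile j)) ∎

  module _ (u+ : ∀ s → Positive (u s)) where

    Ord-vtx : ∀ s a b c d {e r} → Ord e r → Ord (a N.+ e) (r * vtx (G s) a b c d)
    Ord-vtx s a b c d {e} {r} ord with (a N.+ b) ≡ᵇ (c N.+ d) | b ≡ᵇ c | c <ᵇ b
    ... | false | _     | _     = Ord-0 (zeroʳ r)
    ... | true  | true  | _     = Ord-pow (u+ s) a ord
    ... | true  | false | true  = Ord-resp (*-assoc _ _ _) (Ord-* (1# - u s) (Ord-pow (u+ s) a ord))
    ... | true  | false | false = Ord-0 (zeroʳ r)

    -- Only the leftmost vertex is counted, which is enough to discard large left labels.
    Ord-row : ∀ {S} s a (bs ds : Vec ℕ S) {e r} → Ord e r → Ord (a N.+ e) (r * row G s a bs ds)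
    Ord-row s zero    []       []       ord = Ord-* 1# ord
    Ord-row s (suc a) []       []       ord = Ord-0 (zeroʳ _)
    Ord-row s a       (b ∷ bs) (d ∷ ds) {r = r} ord = Ord-resp (sym (*-∑ r (range D) _))
      (Ord-∑ (range D) λ c → Ord-resp (*-assoc _ _ _) (Ord-* _ (Ord-vtx s a b c d ord)))

    -- Each vertex contributes its left label to the order. By summation by parts, the left labels
    -- from site `suc s` on add up to the difference of the two weighted sizes minus the boundary
    -- term `s * a`.
    Ord-row-size : ∀ {S} s a (bs ds : Vec ℕ S) {e r} E → Ord e r →
      E N.+ (wsize (suc s) (toList bs) N.+ s N.* a) ≤ e N.+ wsize (suc s) (toList ds) →
      Ord E (r * row G (suc s) a bs ds)
    Ord-row-size s zero [] [] {e} E ord le =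
      Ord-* 1# (Ord-mono (NP.m+n≤o⇒m≤o E (≡.subst (E N.+ s N.* 0 ≤_) (NP.+-identityʳ e) le)) ord)
    Ord-row-size s (suc a) [] [] E ord le = Ord-0 (zeroʳ _)
    Ord-row-size s a (b ∷ bs) (d ∷ ds) {e} {r} E ord le = Ord-resp (sym (*-∑ r (range D) _)) (Ord-∑ (range D) term)
      where
      term : ∀ c → Ord E (r * (vtx (G (suc s)) a b c d * row G (suc (suc s)) c bs ds))
      term c with (a N.+ b) N.≟ (c N.+ d)
      ... | no  neq = Ord-0 (*-0ʳ (*-0ˡ (vtx-≢ (G (suc s)) a b c d neq)))
      ... | yes eq  = Ord-resp (*-assoc _ _ _) (Ord-row-size (suc s) c bs ds E (Ord-vtx (suc s) a b c d ord)
                        (wsize-step s a b c d E e _ _ eq le))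

    Ord-transfer : ∀ {S} (b t : Vec ℕ S) {r} → Ord (size (toList b)) r → Ord (size (toList t)) (r * transfer G b t)
    Ord-transfer b t {r} ord = Ord-resp (sym (*-∑ r (range D) _)) (Ord-∑ (range D) λ a →
      Ord-row-size 0 a b t (size (toList t)) ord (NP.≤-reflexive
        (≡.trans (≡.cong (size (toList t) N.+_) (NP.+-identityʳ _)) (NP.+-comm (size (toList t)) _))))

    -- Since ρ_s ≤ μ_s, the G row from ρ to κ has left label κ_s - ρ_s ≥ κ_s - μ_s.
    Ord-parts : ∀ {S} s (bs ks : Vec ℕ S) {e r} → Ord e r → Ord ((sum ks ∸ sum bs) N.+ e) (r * parts s bs ks)
    Ord-parts {S} s bs ks {e} {r} ord = Ord-resp (sym (*-∑ r (range D) _)) (Ord-∑ (range D) λ q →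
      Ord-resp (sym (*-∑ r (range D) _)) (Ord-∑ (range D) λ r′ → term q r′))
      where
      term : ∀ q r′ → Ord ((sum ks ∸ sum bs) N.+ e) (r * part s q r′ bs ks)
      term q r′ with (sum ks ∸ sum bs) N.≤? q
      ... | no  A≰q = Ord-0 (*-0ʳ (part-≢ s q r′ bs ks λ (eq , _) → NP.>⇒≢ (NP.<-≤-trans
              (m<n∸o⇒m+o<n q (sum ks) (sum bs) (NP.≰⇒> A≰q)) (NP.m≤n+m (sum ks) r′)) eq))
      ... | yes A≤q = Ord-mono (NP.+-monoˡ-≤ e A≤q) (Ord-resp (sym (*-∑ r (states S) _)) (Ord-∑ (states S) λ t →
              Ord-resp (*-assoc _ _ _) (Ord-* _ (Ord-row s q t ks ord))))

    skewCauchy : Positive p → ∀ (μ κ : Vec ℕ D) {r} → All (_≤ D) κ → Ord (size (toList μ)) r →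
      r * ∑ (states D) (λ t → transfer G μ t * transfer g κ t)
      ≈ r * (geom D p * ∑ (states D) (λ t → transfer G t κ * transfer g t μ))
    skewCauchy p+ μ κ {r} κ≤D ord = begin
      r * ∑ (states D) (λ t → transfer G μ t * transfer g κ t)
        ≈⟨ *-congˡ (∑-product (states D) (λ a t → row G 1 a μ t) (λ a t → row g 1 a κ t)) ⟩
      r * ∑ (range D) F
        ≈⟨ *-∑ r (range D) F ⟩
      ∑ (range D) (λ a → r * F a)
        -- Left labels above D contribute zero, so the range may be lengthened by `A`; after the
        -- shift by `A` it has the D + 1 terms of `geom`.
        ≈⟨ sym (∑-window 0 D (λ a → r * F a) (NP.m≤n+m D A) λ { a _ (inj₂ D<a) → vanish a (NP.≤-trans D<a (NP.m≤m+n a e)) }) ⟩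
      ∑ (range (A N.+ D)) (λ a → r * F a)
        ≈⟨ ∑-window A D (λ a → r * F a) NP.≤-refl outside ⟩
      ∑ (range D) (λ i → r * F (A N.+ i))
        ≈⟨ ∑-cong (range D) closed ⟩
      ∑ (range D) (λ i → r * (pow p i * parts 1 μ κ))
        ≈⟨ sym (*-∑ r (range D) _) ⟩
      r * ∑ (range D) (λ i → pow p i * parts 1 μ κ)
        ≈⟨ *-congˡ (sym (∑-* _ (range D) (pow p))) ⟩
      r * (∑ (range D) (pow p) * parts 1 μ κ)
        ≈⟨ *-congˡ (*-cong (sym (sumL-map (range D) (pow p)))
             (sym (∑-product (states D) (λ q t → row G 1 q t κ) (λ q t → row g 1 q t μ)))) ⟩
      r * (geom D p * ∑ (states D) (λ t → transfer G t κ * transfer g t μ)) ∎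
      where
      M = sum μ
      N = sum κ
      A = N ∸ M
      A′ = M ∸ N
      e = size (toList μ)
      F : ℕ → Carrier
      F a = ∑ (range D) λ a′ → meet 1 a a′ μ κ
      vanish : ∀ a → suc D ≤ a N.+ e → r * F a ≈ 0#
      vanish a D<a+e = Ord-top D<a+e (Ord-resp (sym (*-∑ r (range D) _)) (Ord-∑ (range D) λ a′ →
        Ord-resp (sym (*-∑ r (states D) _)) (Ord-∑ (states D) λ t →
          Ord-resp (*-assoc _ _ _) (Ord-* _ (Ord-row 1 a μ t ord)))))
      outside : ∀ a → a ≤ A N.+ D → a < A ⊎ A N.+ D < a → r * F a ≈ 0#
      outside a _   (inj₁ a<A) = *-0ʳ (∑-zero (range D) λ a′ → meet-≢ 1 a a′ μ κ
        (NP.>⇒≢ (NP.<-≤-trans (m<n∸o⇒m+o<n a N M a<A) (NP.m≤n+m N a′))))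
      outside a a≤  (inj₂ <a)  = ⊥-elim (NP.<⇒≱ <a a≤)
      rearr : ∀ a j n → a N.+ j N.+ n ≡ a N.+ n N.+ j
      rearr = solve-∀
      shift : ∀ i → A′ N.+ i N.+ N ≡ A N.+ i N.+ M
      shift i = ≡.trans (rearr A′ i N) (≡.trans (≡.cong (N._+ i) (∸-balance M N)) (rearr A M i))
      closed : ∀ i → r * F (A N.+ i) ≈ r * (pow p i * parts 1 μ κ)
      -- In high order both sides vanish, the right one through `pow p i` together with the order
      -- `A` of `parts`. Otherwise λ_1 = A + i + M is at most D, and all labels fit.
      closed i with suc D N.≤? (A N.+ i N.+ e)
      ... | yes D< = trans (vanish (A N.+ i) D<) (sym (Ord-top (≡.subst (suc D ≤_) (swap A i e) D<)
            (Ord-resp (solve 3 (λ r t q → (r ⊕ t) ⊕ q ⊜ r ⊕ (q ⊕ t)) refl r (parts 1 μ κ) (pow p i))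
              (Ord-pow p+ i (Ord-parts 1 μ κ ord)))))
        where
        swap : ∀ a i e → a N.+ i N.+ e ≡ i N.+ (a N.+ e)
        swap = solve-∀
      ... | no  D≮ = trans
            (*-congˡ (∑-range-single (A′ N.+ i) _ (NP.m+n≤o⇒m≤o (A′ N.+ i) (≡.subst (_≤ D) (≡.sym (shift i)) a+M≤D))
              λ a′ a′≢ → meet-≢ 1 (A N.+ i) a′ μ κ λ eq → a′≢ (NP.+-cancelʳ-≡ N a′ (A′ N.+ i) (≡.trans eq (≡.sym (shift i))))))
            (meet-closed p+ 0 μ κ i ord ≡.refl κ≤D NP.≤-refl (λ _ → z≤n) a+M≤D)
        where
        a+M≤D : A N.+ i N.+ M ≤ D
        a+M≤D = NP.≤-trans (NP.+-monoʳ-≤ (A N.+ i) (sum≤wsize 0 μ)) (NP.≤-pred (NP.≰⇒> D≮))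

-- From the skew identity to the Cauchy identity.

wsize-replicate-0 : ∀ s S → wsize s (toList (replicate S 0)) ≡ 0
wsize-replicate-0 s zero    = ≡.refl
wsize-replicate-0 s (suc S) = ≡.cong₂ N._+_ (NP.*-zeroʳ s) (wsize-replicate-0 (suc s) S)

module Cauchy {c ℓ} (R : CommutativeRing c ℓ) (D : ℕ) {m} (x : Vec (CommutativeRing.Carrier R) m)
  (z zinv : ℕ → CommutativeRing.Carrier R)
  (z-inverse : ∀ s → CommutativeRing._≈_ R (CommutativeRing._*_ R (z s) (zinv s)) (CommutativeRing.1# R))
  (nilpotent : ∀ (α : Vec ℕ m) → sum α ≡ suc D →
    CommutativeRing._≈_ R (Lattice.monomial R x α) (CommutativeRing.0# R)) where
  open Lattice R
  open FiniteSums R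
  open Transfer R D
  open Order R D x
  open SetoidReasoning setoid
  open CommutativeMonoidSolver *-commutativeMonoid using (solve; _⊕_; _⊜_)

  G-row g-row : Carrier → RowWeight
  G-row v s = U (v * zinv s)
  g-row y s a b c d = pow (y * z s) (a ⊓ d)

  vacuum : Vec ℕ D
  vacuum = replicate D 0

  Ord-vacuum : Ord (size (toList vacuum)) 1#
  Ord-vacuum = Ord-mono (NP.≤-reflexive (wsize-replicate-0 1 D)) (Ord-bottom nilpotent)

  -- This cancellation makes the factor passed between sites independent of the site, and removes
  -- the parameters z from the product side.
  weights-inverse : ∀ v y s → (v * zinv s) * (y * z s) ≈ v * y
  weights-inverse v y s = begin
    (v * zinv s) * (y * z s) ≈⟨ solve 4 (λ v i y z → (v ⊕ i) ⊕ (y ⊕ z) ⊜ (v ⊕ y) ⊕ (z ⊕ i)) refl v (zinv s) y (z s) ⟩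
    (v * y) * (z s * zinv s) ≈⟨ *-congˡ (z-inverse s) ⟩
    (v * y) * 1#             ≈⟨ *-identityʳ _ ⟩
    v * y                    ∎

  skew : ∀ {v} → Positive v → ∀ y (μ κ : Vec ℕ D) {r} → All (_≤ D) κ → Ord (size (toList μ)) r →
    r * ∑ (states D) (λ t → transfer (G-row v) μ t * transfer (g-row y) κ t)
    ≈ r * (geom D (v * y) * ∑ (states D) (λ t → transfer (G-row v) t κ * transfer (g-row y) t μ))
  skew {v} v+ y = SkewCauchy.skewCauchy R D x (λ s → v * zinv s) (λ s → y * z s) (v * y) (weights-inverse v y)
    (λ s → Positive-* (zinv s) v+) (Positive-* y v+)

  Ord-G-transfer : ∀ {v} → Positive v → ∀ (b t : Vec ℕ D) {r} → Ord (size (toList b)) r →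
    Ord (size (toList t)) (r * transfer (G-row v) b t)
  Ord-G-transfer {v} v+ = SkewCauchy.Ord-transfer R D x (λ s → v * zinv s) (λ s → 1# * z s) (v * 1#)
    (weights-inverse v 1#) (λ s → Positive-* (zinv s) v+)

  Ord-evolve : ∀ {xs} → ListAll.All Positive xs → ∀ (b t : Vec ℕ D) {r} → Ord (size (toList b)) r →
    Ord (size (toList t)) (r * evolve (map G-row xs) b t)
  Ord-evolve []         b t {r} ord with ≡-dec N._≟_ b t
  ... | yes ≡.refl = Ord-* _ ord
  ... | no  b≢t    = Ord-0 (trans (*-congˡ (evolve-[]-≢ b≢t)) (zeroʳ r))
  Ord-evolve (v+ ∷ xs+) b t {r} ord = Ord-resp (sym (*-∑ r (states D) _)) (Ord-∑ (states D) λ t′ →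
    Ord-resp (*-assoc _ _ _) (Ord-evolve xs+ t′ t (Ord-G-transfer v+ b t′ ord)))

  kernel : List Carrier → Carrier → Carrier
  kernel xs y = prodL (map (λ v → geom D (v * y)) xs)

  -- The g row is moved through the G rows one at a time, each exchange costing one geometric
  -- factor. The order of `r` must match the size of μ for every intermediate μ, hence the general
  -- `r`.
  intertwine : ∀ {xs} → ListAll.All Positive xs → ∀ y (μ κ : Vec ℕ D) {r} → All (_≤ D) μ → All (_≤ D) κ →
    Ord (size (toList μ)) r →
    r * ∑ (states D) (λ t → transfer (g-row y) κ t * evolve (map G-row xs) μ t)
    ≈ r * (kernel xs y * ∑ (states D) (λ t → evolve (map G-row xs) t κ * transfer (g-row y) t μ))
  intertwine [] y μ κ μ≤ κ≤ ord = *-congˡ (begin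
    ∑ (states D) (λ t → transfer (g-row y) κ t * evolve [] μ t)
      ≈⟨ ∑-states-single μ≤ _ (λ t t≢μ → trans (*-congˡ (evolve-[]-≢ (t≢μ ∘ ≡.sym))) (zeroʳ _)) ⟩
    transfer (g-row y) κ μ * evolve [] μ μ
      ≈⟨ trans (*-congˡ (evolve-[]-refl μ)) (trans (*-comm _ _) (*-congʳ (sym (evolve-[]-refl κ)))) ⟩
    evolve [] κ κ * transfer (g-row y) κ μ
      ≈⟨ sym (∑-states-single κ≤ (λ t → evolve [] t κ * transfer (g-row y) t μ)
           λ t t≢κ → trans (*-congʳ (evolve-[]-≢ t≢κ)) (zeroˡ _)) ⟩
    ∑ (states D) (λ t → evolve [] t κ * transfer (g-row y) t μ)
      ≈⟨ sym (*-identityˡ _) ⟩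
    1# * ∑ (states D) (λ t → evolve [] t κ * transfer (g-row y) t μ) ∎)
  intertwine {v ∷ xs} (v+ ∷ xs+) y μ κ {r} μ≤ κ≤ ord = begin
    r * ∑ (states D) (λ t → h κ t * ∑ (states D) λ s → H μ s * E s t)
      ≈⟨ *-congˡ (trans (∑-cong (states D) λ t → *-∑ _ (states D) _) (∑-swap (states D) (states D) _)) ⟩
    r * ∑ (states D) (λ s → ∑ (states D) λ t → h κ t * (H μ s * E s t))
      ≈⟨ *-∑ r (states D) _ ⟩
    ∑ (states D) (λ s → r * ∑ (states D) λ t → h κ t * (H μ s * E s t))
      ≈⟨ ∑-cong (states D) (λ s → trans (*-congˡ (trans
           (∑-cong (states D) λ t → solve 3 (λ a b c → a ⊕ (b ⊕ c) ⊜ b ⊕ (a ⊕ c)) refl (h κ t) (H μ s) (E s t))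
           (sym (*-∑ (H μ s) (states D) _)))) (sym (*-assoc _ _ _))) ⟩
    ∑ (states D) (λ s → (r * H μ s) * ∑ (states D) λ t → h κ t * E s t)
      -- The new prefix `r * H μ s` has order at least the size of `s`.
      ≈⟨ ∑-states-cong D (λ s s≤ → intertwine xs+ y s κ s≤ κ≤ (Ord-G-transfer v+ μ s ord)) ⟩
    ∑ (states D) (λ s → (r * H μ s) * (kernel xs y * ∑ (states D) λ t → E t κ * h t s))
      ≈⟨ ∑-cong (states D) (λ s → trans (sym (*-assoc _ _ _)) (trans (*-∑ _ (states D) _) (∑-cong (states D) λ t →
           solve 5 (λ r a k e b → ((r ⊕ a) ⊕ k) ⊕ (e ⊕ b) ⊜ (k ⊕ e) ⊕ (r ⊕ (a ⊕ b))) refl r (H μ s) (kernel xs y) (E t κ) (h t s)))) ⟩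
    ∑ (states D) (λ s → ∑ (states D) λ t → (kernel xs y * E t κ) * (r * (H μ s * h t s)))
      ≈⟨ ∑-swap (states D) (states D) _ ⟩
    ∑ (states D) (λ t → ∑ (states D) λ s → (kernel xs y * E t κ) * (r * (H μ s * h t s)))
      ≈⟨ ∑-cong (states D) (λ t → trans (sym (*-∑ _ (states D) _)) (*-congˡ (sym (*-∑ r (states D) _)))) ⟩
    ∑ (states D) (λ t → (kernel xs y * E t κ) * (r * ∑ (states D) λ s → H μ s * h t s))
      ≈⟨ ∑-states-cong D (λ t t≤ → *-congˡ (skew v+ y μ t t≤ ord)) ⟩
    ∑ (states D) (λ t → (kernel xs y * E t κ) * (r * (geom D (v * y) * ∑ (states D) λ s → H s t * h s μ)))
      ≈⟨ ∑-cong (states D) (λ t → trans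
           (solve 5 (λ k e r c q → (k ⊕ e) ⊕ (r ⊕ (c ⊕ q)) ⊜ (r ⊕ (c ⊕ k)) ⊕ (e ⊕ q)) refl
              (kernel xs y) (E t κ) r (geom D (v * y)) (∑ (states D) λ s → H s t * h s μ))
           (*-congˡ (trans (*-∑ _ (states D) _) (∑-cong (states D) λ s →
              solve 3 (λ e a b → e ⊕ (a ⊕ b) ⊜ (a ⊕ e) ⊕ b) refl (E t κ) (H s t) (h s μ))))) ⟩
    ∑ (states D) (λ t → (r * kernel (v ∷ xs) y) * ∑ (states D) λ s → (H s t * E t κ) * h s μ)
      ≈⟨ sym (*-∑ _ (states D) _) ⟩
    (r * kernel (v ∷ xs) y) * ∑ (states D) (λ t → ∑ (states D) λ s → (H s t * E t κ) * h s μ)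
      ≈⟨ *-assoc _ _ _ ⟩
    r * (kernel (v ∷ xs) y * ∑ (states D) (λ t → ∑ (states D) λ s → (H s t * E t κ) * h s μ))
      ≈⟨ *-congˡ (*-congˡ (trans (∑-swap (states D) (states D) _) (∑-cong (states D) λ s → sym (∑-* (h s μ) (states D) _)))) ⟩
    r * (kernel (v ∷ xs) y * ∑ (states D) (λ s → evolve (map G-row (v ∷ xs)) s κ * h s μ)) ∎
    where
    H h E : Vec ℕ D → Vec ℕ D → Carrier
    H = transfer (G-row v)
    h = transfer (g-row y)
    E = evolve (map G-row xs)

  module _ {xs} (xs+ : ListAll.All Positive xs) where

    -- The vector (G_λ)_λ.
    Gvec : Vec ℕ D → Carrier
    Gvec = evolve (map G-row xs) vacuum

    eigenvector : ∀ y κ → All (_≤ D) κ →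
      ∑ (states D) (λ t → transfer (g-row y) κ t * Gvec t) ≈ kernel xs y * Gvec κ
    eigenvector y κ κ≤ = begin
      ∑ (states D) (λ t → transfer (g-row y) κ t * Gvec t)
        -- The empty partition has size 0, so the prefix `1#` has the required order and the
        -- identity holds exactly.
        ≈⟨ trans (sym (*-identityˡ _)) (trans (intertwine xs+ y vacuum κ (All-replicate-0 D D) κ≤ Ord-vacuum) (*-identityˡ _)) ⟩
      kernel xs y * ∑ (states D) (λ t → evolve (map G-row xs) t κ * transfer (g-row y) t vacuum)
        ≈⟨ *-congˡ (∑-states-single (All-replicate-0 D D) _ λ t t≢0 → trans (*-congˡ (transfer-≢0 t≢0)) (zeroʳ _)) ⟩
      kernel xs y * (Gvec κ * transfer (g-row y) vacuum vacuum)
        ≈⟨ *-congˡ (trans (*-congˡ (transfer-0 D)) (*-identityʳ _)) ⟩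
      kernel xs y * Gvec κ ∎
      where open Vacuum (g-row y) (λ s → refl)

    -- The lowest g row is peeled off first, which makes the remaining rows start at an arbitrary κ;
    -- the eigenvector equation then absorbs the peeled row.
    pairing : ∀ ys κ → All (_≤ D) κ →
      ∑ (states D) (λ t → Gvec t * evolve (map g-row ys) κ t) ≈ prodL (map (kernel xs) ys) * Gvec κ
    pairing [] κ κ≤ = begin
      ∑ (states D) (λ t → Gvec t * evolve [] κ t)
        ≈⟨ ∑-states-single κ≤ _ (λ t t≢κ → trans (*-congˡ (evolve-[]-≢ (t≢κ ∘ ≡.sym))) (zeroʳ _)) ⟩
      Gvec κ * evolve [] κ κ
        ≈⟨ trans (*-congˡ (evolve-[]-refl κ)) (*-comm _ _) ⟩
      1# * Gvec κ ∎
    pairing (y ∷ ys) κ κ≤ = begin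
      ∑ (states D) (λ t → Gvec t * ∑ (states D) λ s → transfer (g-row y) κ s * evolve (map g-row ys) s t)
        ≈⟨ trans (∑-cong (states D) λ t → *-∑ _ (states D) _) (∑-swap (states D) (states D) _) ⟩
      ∑ (states D) (λ s → ∑ (states D) λ t → Gvec t * (transfer (g-row y) κ s * evolve (map g-row ys) s t))
        ≈⟨ ∑-cong (states D) (λ s → trans (∑-cong (states D) λ t →
             solve 3 (λ a b c → a ⊕ (b ⊕ c) ⊜ b ⊕ (a ⊕ c)) refl (Gvec t) (transfer (g-row y) κ s) (evolve (map g-row ys) s t))
             (sym (*-∑ _ (states D) _))) ⟩
      ∑ (states D) (λ s → transfer (g-row y) κ s * ∑ (states D) λ t → Gvec t * evolve (map g-row ys) s t)
        ≈⟨ ∑-states-cong D (λ s s≤ → trans (*-congˡ (pairing ys s s≤))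
             (solve 3 (λ a b c → a ⊕ (b ⊕ c) ⊜ b ⊕ (a ⊕ c)) refl (transfer (g-row y) κ s) (prodL (map (kernel xs) ys)) (Gvec s))) ⟩
      ∑ (states D) (λ s → prodL (map (kernel xs) ys) * (transfer (g-row y) κ s * Gvec s))
        ≈⟨ sym (*-∑ _ (states D) _) ⟩
      prodL (map (kernel xs) ys) * ∑ (states D) (λ s → transfer (g-row y) κ s * Gvec s)
        ≈⟨ *-congˡ (eigenvector y κ κ≤) ⟩
      prodL (map (kernel xs) ys) * (kernel xs y * Gvec κ)
        ≈⟨ solve 3 (λ a b c → a ⊕ (b ⊕ c) ⊜ (b ⊕ a) ⊕ c) refl _ _ _ ⟩
      prodL (map (kernel xs) (y ∷ ys)) * Gvec κ ∎

    Gvec-vacuum : Gvec vacuum ≈ 1#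
    Gvec-vacuum = proj₁ (evolve-vacuum (map G-row xs) (normalised xs))
      where
      normalised : ∀ xs → ListAll.All (λ W → ∀ s → W s 0 0 0 0 ≈ 1#) (map G-row xs)
      normalised []       = []
      normalised (v ∷ xs) = (λ s → refl) ∷ normalised xs

    Gvec-large : ∀ t → D < size (toList t) → Gvec t ≈ 0#
    Gvec-large t D<t = Ord-top D<t (Ord-resp (*-identityˡ _) (Ord-evolve xs+ vacuum t Ord-vacuum))

  prodL-++ : ∀ us vs → prodL (us ++ vs) ≈ prodL us * prodL vs
  prodL-++ []       vs = sym (*-identityˡ _)
  prodL-++ (u ∷ us) vs = trans (*-congˡ (prodL-++ us vs)) (sym (*-assoc _ _ _))

  prodL-1 : ∀ (ys : List Carrier) → prodL (map (λ _ → 1#) ys) ≈ 1#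
  prodL-1 []       = refl
  prodL-1 (y ∷ ys) = trans (*-identityˡ _) (prodL-1 ys)

  prodL-* : ∀ (f h : Carrier → Carrier) ys → prodL (map (λ y → f y * h y) ys) ≈ prodL (map f ys) * prodL (map h ys)
  prodL-* f h []       = sym (*-identityˡ 1#)
  prodL-* f h (y ∷ ys) = trans (*-congˡ (prodL-* f h ys))
    (solve 4 (λ p q r s → (p ⊕ q) ⊕ (r ⊕ s) ⊜ (p ⊕ r) ⊕ (q ⊕ s)) refl _ _ _ _)

  prodL-kernel : ∀ xs ys → prodL (map (kernel xs) ys) ≈ prodL (concatMap (λ v → map (λ y → geom D (v * y)) ys) xs)
  prodL-kernel []       ys = prodL-1 ys
  prodL-kernel (v ∷ xs) ys = begin
    prodL (map (kernel (v ∷ xs)) ys)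
      ≈⟨ prodL-* (λ y → geom D (v * y)) (kernel xs) ys ⟩
    prodL (map (λ y → geom D (v * y)) ys) * prodL (map (kernel xs) ys)
      ≈⟨ *-congˡ (prodL-kernel xs ys) ⟩
    prodL (map (λ y → geom D (v * y)) ys) * prodL (concatMap (λ v → map (λ y → geom D (v * y)) ys) xs)
      ≈⟨ sym (prodL-++ (map (λ y → geom D (v * y)) ys) _) ⟩
    prodL (concatMap (λ v → map (λ y → geom D (v * y)) ys) (v ∷ xs)) ∎

  cauchy : ∀ {n} (y : Vec Carrier n) → cauchyLHS D x y z zinv ≈ cauchyRHS D x y
  cauchy y = begin
    cauchyLHS D x y z zinv
      ≈⟨ trans (sumL-map (partitionsUpTo D) _) (trans (∑-filter _ (tuples D D) _) (∑-tuples D _)) ⟩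
    ∑ (states D) (λ t → if size (toList t) ≤ᵇ D then Gλ D x zinv (toList t) * gλ D y z (toList t) else 0#)
      ≈⟨ ∑-cong (states D) unfilter ⟩
    ∑ (states D) (λ t → Gvec x-positive t * evolve (map g-row (toList y)) vacuum t)
      ≈⟨ pairing x-positive (toList y) vacuum (All-replicate-0 D D) ⟩
    prodL (map (kernel (toList x)) (toList y)) * Gvec x-positive vacuum
      ≈⟨ trans (*-congˡ (Gvec-vacuum x-positive)) (*-identityʳ _) ⟩
    prodL (map (kernel (toList x)) (toList y))
      ≈⟨ prodL-kernel (toList x) (toList y) ⟩
    cauchyRHS D x y ∎
    where
    unfilter : ∀ t → (if size (toList t) ≤ᵇ D then Gλ D x zinv (toList t) * gλ D y z (toList t) else 0#)
      ≈ Gvec x-positive t * evolve (map g-row (toList y)) vacuum t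
    unfilter t with size (toList t) ≤ᵇ D in eq
    ... | true  = *-cong (Z≈evolve (map G-row (toList x)) t) (Z≈evolve (map g-row (toList y)) t)
    -- The vectors removed by the size filter already have vanishing G factor.
    ... | false = sym (trans (*-congʳ (Gvec-large x-positive t (NP.≰⇒> λ le → ≡.subst Bool.T eq (NP.≤⇒≤ᵇ le)))) (zeroˡ _))

theorem6p6 : ∀ {c ℓ} (R : CommutativeRing c ℓ) → let open Lattice R in
    (m n D : ℕ) (x : Vec Carrier m) (y : Vec Carrier n) (z zinv : ℕ → Carrier) →
    (∀ s → z s * zinv s ≈ 1#) →
    (∀ (α : Vec ℕ m) → sum α ≡ suc D → monomial x α ≈ 0#) →
    cauchyLHS D x y z zinv ≈ cauchyRHS D x y
theorem6p6 R m n D x y z zinv z-inverse nilpotent = Cauchy.cauchy R D x z zinv z-inverse nilpotent y
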